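{- Let $p\in\{3,5,7,11,13,19\}$ and $1\le\beta\le\frac{p-1}{2}$, and let $\beta^*\in[1,p-1]$ denote the inverse of $\beta$ modulo $p$. Let $v=v(p,\beta)$ be given by the following table (rows $p$, entries listed for $\beta=1,2,\dots,\frac{p-1}{2}$; an asterisk marks a "boldface" entry): $p=3$: $2^*$; $p=5$: $3^*,3^*$; $p=7$: $4^*,4^*,4^*$; $p=11$: $6^*,6^*,7^*,7^*,6$; $p=13$: $7^*,7^*,7,8^*,8^*,7$; $p=19$: $10^*,10^*,10,12^*,11,9,11^*,11,10$. Then $v\le M_\beta(p)\le m(\beta^*)$, and if the entry is marked with an asterisk then $M_\beta(p)=v$.
   Context: For a positive integer $n$, write the $n$-th cyclotomic polynomial as $\Phi_n(x)=\sum_{k=0}^{\varphi(n)}a_n(k)x^k$ and let its height be $A(n)=\max_k|a_n(k)|$. For an odd prime $p$ and a prime $q>p$, let $M(p;q)=\max\{A(pqr): r \text{ prime}, r>q\}$. For $1\le\beta\le p-1$, let $M_\beta(p)=\max\{M(p;q): q>p \text{ prime},\ q\equiv\beta \pmod p\}$ (this maximum exists). For the odd prime $p$ and $1\le j\le p-1$, define $w(j)=\frac{p-1}{2}+j$ if $j<\frac p4$; $w(j)=p-j$ if $\frac p4<j\le\frac{p-1}{2}$; $w(j)=w(p-j)$ if $j>\frac{p-1}{2}$; and $m(j)=\min\{w(j),\lfloor\frac{2}{3}p\rfloor\}$. -}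

module Defs where

open import Data.Bool using (Bool; true; false; if_then_else_; not)
import Data.Bool
open import Data.Nat using (ℕ; zero; suc; _+_; _*_; _∸_; _≤_; _<_; _≤ᵇ_; _≡ᵇ_; _⊔_; _⊓_; _/_; _%_)
open import Data.Nat.Divisibility using (_∣_; _∣?_)
open import Data.Nat.Primality using (Prime; prime?)
open import Data.Nat.GCD using (gcd)
open import Data.Integer as ℤ using (ℤ; +_; -[1+_]; ∣_∣)
open import Data.List using (List; []; _∷_; map; foldr; upTo; filter; length)
open import Data.Product using (_×_; _,_; Σ; ∃)
open import Relation.Nullary.Decidable using (⌊_⌋)
open import Relation.Binary.PropositionalEquality using (_≡_)

Series : Set
Series = ℕ → ℤ

oneS : Series
oneS zero    = + 1
oneS (suc _) = + 0

sumℤ : List ℤ → ℤ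
sumℤ = foldr ℤ._+_ (+ 0)

mulOneMinus : ℕ → Series → Series
mulOneMinus d s k = s k ℤ.- (if d ≤ᵇ k then s (k ∸ d) else + 0)

-- multiply a series by 1/(1 - x^d) = Σ_j x^{dj}   (used with d ≥ 1)
divOneMinus : ℕ → Series → Series
divOneMinus d s k =
  sumℤ (map (λ j → if d * j ≤ᵇ k then s (k ∸ d * j) else + 0) (upTo (suc k)))

iter : ℕ → (Series → Series) → Series → Series
iter zero    f s = s
iter (suc n) f s = f (iter n f s)

mulPow : ℕ → ℤ → Series → Series
mulPow d (+ n)     s = iter n (mulOneMinus d) s
mulPow d -[1+ n ]  s = iter (suc n) (divOneMinus d) s

-- positive divisors of n (n ≥ 1), each listed as its predecessor d - 1
divisors⁻ : ℕ → List ℕ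
divisors⁻ n = filter (λ d → suc d ∣? n) (upTo n)

divisors : ℕ → List ℕ
divisors n = map suc (divisors⁻ n)

allB : (ℕ → Bool) → List ℕ → Bool
allB f = foldr (λ x b → Data.Bool._∧_ (f x) b) true

ω : ℕ → ℕ
ω n = length (filter (λ d → prime? d) (divisors n))

squarefree : ℕ → Bool
squarefree n = allB (λ d → not ⌊ (suc (suc d) * suc (suc d)) ∣? n ⌋) (upTo n)

-- Möbius function (μ 0 = 0 by convention; unused)
μ : ℕ → ℤ
μ zero = + 0
μ n@(suc _) =
  if squarefree n
  then (if (ω n % 2) ≡ᵇ 0 then + 1 else ℤ.- (+ 1))
  else + 0

φ : ℕ → ℕ
φ n = length (filter (λ k → gcd k n Data.Nat.≟ 1) (map suc (upTo n)))

-- Cyclotomic polynomials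
-- For n ≥ 2:  Φ_n(x) = ∏_{d ∣ n} (1 - x^d)^{μ(n/d)}  (an identity of power
-- series, whose right side is a polynomial of degree φ(n));
-- Φ_1(x) = x - 1.

cycSeries : ℕ → Series
cycSeries n = foldr (λ d s → mulPow (suc d) (μ (n / suc d)) s) oneS (divisors⁻ n)

a : ℕ → ℕ → ℤ
a zero    k = + 0
a (suc zero) zero = -[1+ 0 ]
a (suc zero) (suc zero) = + 1
a (suc zero) (suc (suc k)) = + 0
a n@(suc (suc _)) k = cycSeries n k

A : ℕ → ℕ
A n = foldr _⊔_ 0 (map (λ k → ∣ a n k ∣) (upTo (suc (φ n))))

IsM : ℕ → ℕ → ℕ → Set
IsM p q M =
  (Σ ℕ λ r → Prime r × q < r × A (p * q * r) ≡ M) ×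
  (∀ r → Prime r → q < r → A (p * q * r) ≤ M)

-- M is the maximum of { M(p;q) : q > p prime, q ≡ β (mod p) }
-- (for 1 ≤ β ≤ p-1 < q, "q ≡ β (mod p)" is "p ∣ q - β")
IsMβ : ℕ → ℕ → ℕ → Set
IsMβ p β M =
  (Σ ℕ λ q → Prime q × p < q × p ∣ q ∸ β × IsM p q M) ×
  (∀ q → Prime q → p < q → p ∣ q ∸ β → ∀ M′ → IsM p q M′ → M′ ≤ M)

-- w(j), m(j)  (for odd prime p, 1 ≤ j ≤ p-1; note p/4 is never an integer,
-- so "j < p/4" is 4j < p and "p/4 < j" is its negation)

w₀ : ℕ → ℕ → ℕ
w₀ p j = if suc (4 * j) ≤ᵇ p then (p ∸ 1) / 2 + j else p ∸ j

w : ℕ → ℕ → ℕ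
w p j = if j ≤ᵇ (p ∸ 1) / 2 then w₀ p j else w₀ p (p ∸ j)

m : ℕ → ℕ → ℕ
m p j = w p j ⊓ ((2 * p) / 3)

record Entry : Set where
  constructor entry
  field
    prm  : ℕ
    bet  : ℕ
    val  : ℕ
    bold : Bool

table : List Entry
table =
  entry 3 1 2 true ∷
  entry 5 1 3 true ∷ entry 5 2 3 true ∷
  entry 7 1 4 true ∷ entry 7 2 4 true ∷ entry 7 3 4 true ∷
  entry 11 1 6 true ∷ entry 11 2 6 true ∷ entry 11 3 7 true ∷ entry 11 4 7 true ∷ entry 11 5 6 false ∷
  entry 13 1 7 true ∷ entry 13 2 7 true ∷ entry 13 3 7 false ∷ entry 13 4 8 true ∷ entry 13 5 8 true ∷ entry 13 6 7 false ∷
  entry 19 1 10 true ∷ entry 19 2 10 true ∷ entry 19 3 10 false ∷ entry 19 4 12 true ∷ entry 19 5 11 false ∷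
  entry 19 6 9 false ∷ entry 19 7 11 true ∷ entry 19 8 11 false ∷ entry 19 9 10 false ∷
  []

{-# OPTIONS --safe #-}

-- Write n = q⁻¹ mod p (so n = β*), b = r⁻¹ mod p, c = (rp)⁻¹ mod q.  From
-- Φ_pqr(x) = Φ_pq(x^r) · (1 + … + x^(p-1)) (1 − x^q) / (1 − x^pq) and the explicit form of Φ_pq one gets
--   a_pqr(k) = Σ_{i<p} (h(x_i, y_i) − h(x_i, y_i − b)),   x_i = c(k − i) mod q,   y_i = nb(k − i) mod p,
-- where h(x, y) ∈ {−1, 0, 1} depends, besides y and K = ⌊⌊k/r⌋/q⌋, only on α = ⌊px/q⌋ and on the bit ε telling
-- whether px mod q exceeds ⌊k/r⌋ mod q.
--
-- Upper bound.  The y_i run through all residues mod p, so a_pqr(k) is at most the sum over y of the largest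
-- summand with that y; for these p this finite quantity is Bzdęga's bound min(2α + β, p − β), hence at most w(β*).  In the few
-- cases where it exceeds ⌊2p/3⌋, use that (x_i) is an orbit of a rotation: (α, ε) at i + 1 is determined by (α, ε) at i
-- up to few choices, and a dynamic program over (α, ε) shows that the summands cannot all be that large.
--
-- Lower bound.  For each table entry one coefficient of one explicit Φ_pqr is evaluated with the formula above.
module Submission where

open import Defs
open import Data.Bool using (Bool; true; false; if_then_else_; T; not; _∧_)
open import Data.Empty using (⊥-elim)
open import Data.Nat using (ℕ; zero; suc; pred; _+_; _*_; _∸_; _≤_; _<_; _≤ᵇ_; _<ᵇ_; _≡ᵇ_; _⊔_; _⊓_; _/_; _%_; z≤n; s≤s; NonZero; >-nonZero; nonTrivial⇒n>1)
open import Data.Nat.Coprimality using (Coprime; coprime-divisor; coprime-Bézout)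
open import Data.Nat.Divisibility
open import Data.Nat.DivMod using (m≡m%n+[m/n]*n; m%n<n; m*n/n≡m; [m+kn]%n≡m%n; m<n⇒m%n≡m; m<n*o⇒m/o<n)
open import Data.Nat.GCD using (gcd; gcd[m,n]∣m; gcd[m,n]∣n; module Bézout)
open import Data.Nat.Induction using (<-rec)
open import Data.Nat.ListAction using (sum; product)
open import Data.Nat.ListAction.Properties using (sum-↭)
open import Data.Nat.Primality
open import Data.Nat.Primality.Factorisation using (factorisationHasAllPrimeFactors)
import Data.Nat.Properties as ℕ
open import Data.Nat.Tactic.RingSolver using (solve-∀)
open import Algebra.Properties.CommutativeSemigroup ℕ.+-commutativeSemigroup using (interchange)
open import Data.Integer as ℤ using (ℤ; +_; -[1+_])
open import Data.Integer.DivMod using (_%ℕ_; _/ℕ_; n%ℕd<d; a≡a%ℕn+[a/ℕn]*n)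
import Data.Integer.Divisibility.Signed as ℤ∣
open ℤ∣ using () renaming (_∣_ to _∣ℤ_)
import Data.Integer.Properties as ℤ
open import Data.Integer.Solver using (module +-*-Solver)
open +-*-Solver using (solve; _:=_; _:+_; _:*_; _:-_; :-_; con)
open import Data.List using (List; []; _∷_; map; foldr; upTo; applyUpTo; filter; length; drop; _++_)
import Data.List.Properties as List
open import Data.List.Membership.Propositional using (_∈_)
open import Data.List.Membership.Propositional.Properties
open import Data.List.Membership.Propositional.Properties.WithK using (unique∧set⇒bag)
open import Data.List.Relation.Binary.BagAndSetEquality using (∼bag⇒↭)
open import Data.List.Relation.Binary.Permutation.Propositional as Perm using (_↭_)
open import Data.List.Relation.Binary.Permutation.Propositional.Properties as Perm using (↭-length)
open import Data.List.Relation.Unary.All as All using (All; []; _∷_)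
open import Data.List.Relation.Unary.AllPairs using ([]; _∷_)
open import Data.List.Relation.Unary.Any using (here; there)
open import Data.List.Relation.Unary.Unique.Propositional using (Unique)
open import Data.List.Relation.Unary.Unique.Propositional.Properties as Unique using (Unique[x∷xs]⇒x∉xs)
open import Data.Product using (∃; _×_; _,_; proj₁; proj₂)
open import Data.Sum using (_⊎_; inj₁; inj₂)
open import Data.Unit using (tt)
open import Function using (_∘_; id; mk⇔)
open import Relation.Nullary using (¬_; yes; no; contradiction)
open import Relation.Nullary.Decidable using (⌊_⌋; True; toWitness; decidable-stable)
open import Relation.Binary.PropositionalEquality


-- Arithmetic of power series

-- The indices k used for the lower bounds exceed 10^7, and the upper bound concerns infinitely many
-- q and r, so neither half can evaluate the definition of `a`. Both go through the coefficient
-- formula, which has only p summands. For the upper bound everything unbounded is rounded to finite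
-- data: n is β* because q ≡ β, b is one of 1, ..., p - 1, K may be capped at p - 1, and the step c
-- of the rotation survives only as τ = ⌊pc/q⌋ < p. The orbit itself is replaced by all walks that
-- obey the resulting transition rules. This only enlarges the set of sequences over which the sum
-- is maximised, and what remains is a finite search, run by evaluation and proved sound. Another
-- obstacle is that M(p;q) is a maximum over infinitely many r, so for the q of a lower bound it
-- cannot be exhibited. Its existence is used under a double negation, which suffices for a
-- decidable inequality.

infix 4 _≐_
infixl 6 _⊖_

-- Equality has to be pointwise, as function extensionality is not provable; the record wrapper lets
-- unification recover `s` and `t` from the type of a proof.
record _≐_ (s t : Series) : Set where
  constructor pointwise
  field at : ∀ k → s k ≡ t k
open _≐_ public

≐-refl : ∀ {s} → s ≐ s
≐-refl .at k = refl

≐-sym : ∀ {s t} → s ≐ t → t ≐ s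
≐-sym e .at k = sym (e .at k)

≐-trans : ∀ {s t u} → s ≐ t → t ≐ u → s ≐ u
≐-trans e f .at k = trans (e .at k) (f .at k)

_⊖_ : Series → Series → Series
(s ⊖ t) k = s k ℤ.- t k

shift : ℕ → Series → Series
shift d s k = if d ≤ᵇ k then s (k ∸ d) else + 0

≤ᵇ-true : ∀ {m n} → m ≤ n → (m ≤ᵇ n) ≡ true
≤ᵇ-true {m} {n} m≤n with m ≤ᵇ n | ℕ.≤⇒≤ᵇ m≤n
... | true | _ = refl

≤ᵇ-false : ∀ {m n} → n < m → (m ≤ᵇ n) ≡ false
≤ᵇ-false {m} {n} n<m with m ≤ᵇ n in eq
... | false = refl
... | true  = ⊥-elim (ℕ.<⇒≱ n<m (ℕ.≤ᵇ⇒≤ m n (subst T (sym eq) tt)))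

shift-≥ : ∀ {d k} s → d ≤ k → shift d s k ≡ s (k ∸ d)
shift-≥ s d≤k rewrite ≤ᵇ-true d≤k = refl

shift-< : ∀ {d k} s → k < d → shift d s k ≡ + 0
shift-< s k<d rewrite ≤ᵇ-false k<d = refl

shift-cong : ∀ d {s t} → s ≐ t → shift d s ≐ shift d t
shift-cong d e .at k with d ≤ᵇ k
... | true  = e .at (k ∸ d)
... | false = refl

shift-⊖ : ∀ d s t → shift d (s ⊖ t) ≐ shift d s ⊖ shift d t
shift-⊖ d s t .at k with d ≤ᵇ k
... | true  = refl
... | false = refl

shift-shift : ∀ d e s → shift d (shift e s) ≐ shift (d + e) s
shift-shift d e s .at k with ℕ.<-≤-connex k d
... | inj₁ k<d = trans (shift-< (shift e s) k<d) (sym (shift-< s (ℕ.<-≤-trans k<d (ℕ.m≤m+n d e))))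
... | inj₂ d≤k with ℕ.<-≤-connex (k ∸ d) e
...   | inj₁ k∸d<e = trans (shift-≥ (shift e s) d≤k) (trans (shift-< s k∸d<e)
          (sym (shift-< s (subst (_< d + e) (ℕ.m+[n∸m]≡n d≤k) (ℕ.+-monoʳ-< d k∸d<e)))))
...   | inj₂ e≤k∸d = trans (shift-≥ (shift e s) d≤k) (trans (shift-≥ s e≤k∸d)
          (trans (cong s (ℕ.∸-+-assoc k d e))
          (sym (shift-≥ s (subst (d + e ≤_) (ℕ.m+[n∸m]≡n d≤k) (ℕ.+-monoʳ-≤ d e≤k∸d))))))

shift-index : ∀ {d e} s → d ≡ e → shift d s ≐ shift e s
shift-index s refl = ≐-refl

shift-comm : ∀ d e s → shift d (shift e s) ≐ shift e (shift d s)
shift-comm d e s = ≐-trans (shift-shift d e s)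
  (≐-trans (shift-index s (ℕ.+-comm d e)) (≐-sym (shift-shift e d s)))

⊖-cong : ∀ {s s′ t t′} → s ≐ s′ → t ≐ t′ → s ⊖ t ≐ s′ ⊖ t′
⊖-cong e f .at k = cong₂ ℤ._-_ (e .at k) (f .at k)

mul-cong : ∀ d {s t} → s ≐ t → mulOneMinus d s ≐ mulOneMinus d t
mul-cong d e = ⊖-cong e (shift-cong d e)

mul-⊖ : ∀ d s t → mulOneMinus d (s ⊖ t) ≐ mulOneMinus d s ⊖ mulOneMinus d t
mul-⊖ d s t .at k rewrite shift-⊖ d s t .at k =
  solve 4 (λ a b c e → (a :- b) :- (c :- e) := (a :- c) :- (b :- e)) refl
    (s k) (t k) (shift d s k) (shift d t k)

shift-mul : ∀ d e s → shift d (mulOneMinus e s) ≐ mulOneMinus e (shift d s)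
shift-mul d e s = ≐-trans (shift-⊖ d s (shift e s)) (⊖-cong {shift d s} ≐-refl (shift-comm d e s))

mul-comm : ∀ d e s → mulOneMinus d (mulOneMinus e s) ≐ mulOneMinus e (mulOneMinus d s)
mul-comm d e s = ≐-trans (⊖-cong {mulOneMinus e s} ≐-refl (shift-mul d e s))
  (≐-sym (mul-⊖ e s (shift d s)))

-- 1 - x^d is not a zero divisor: the k-th coefficient of the product determines `s k` from the
-- earlier coefficient `s (k ∸ d)`. Together with `mul-div` this yields the later laws of division
-- without unfolding its sum again.
mul-injective : ∀ d → 1 ≤ d → ∀ {s t} → mulOneMinus d s ≐ mulOneMinus d t → s ≐ t
mul-injective d 1≤d {s} {t} e .at = <-rec _ step
  where
  step : ∀ k → (∀ {j} → j < k → s j ≡ t j) → s k ≡ t k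
  step k rec = trans (split s) (trans (cong₂ ℤ._+_ (e .at k) shifts) (sym (split t)))
    where
    split : ∀ u → u k ≡ mulOneMinus d u k ℤ.+ shift d u k
    split u = solve 2 (λ a b → a := (a :- b) :+ b) refl (u k) (shift d u k)
    shifts : shift d s k ≡ shift d t k
    shifts with ℕ.<-≤-connex k d
    ... | inj₁ k<d = trans (shift-< s k<d) (sym (shift-< t k<d))
    ... | inj₂ d≤k = trans (shift-≥ s d≤k)
      (trans (rec (ℕ.∸-monoʳ-< 1≤d d≤k)) (sym (shift-≥ t d≤k)))

sum< : ℕ → (ℕ → ℤ) → ℤ
sum< zero    f = + 0
sum< (suc n) f = f 0 ℤ.+ sum< n (f ∘ suc)

sumℤ-upTo : ∀ n (f : ℕ → ℤ) → sumℤ (map f (upTo n)) ≡ sum< n f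
sumℤ-upTo n f = trans (cong sumℤ (List.map-applyUpTo id f n)) (go n f)
  where
  go : ∀ n (f : ℕ → ℤ) → sumℤ (applyUpTo f n) ≡ sum< n f
  go zero    f = refl
  go (suc n) f = cong (ℤ._+_ (f 0)) (go n (f ∘ suc))

sum<-cong : ∀ n {f g : ℕ → ℤ} → (∀ j → j < n → f j ≡ g j) → sum< n f ≡ sum< n g
sum<-cong zero    e = refl
sum<-cong (suc n) e = cong₂ ℤ._+_ (e 0 (s≤s z≤n)) (sum<-cong n (λ j j<n → e (suc j) (s≤s j<n)))

sum<-0 : ∀ n {f : ℕ → ℤ} → (∀ j → j < n → f j ≡ + 0) → sum< n f ≡ + 0
sum<-0 zero    e = refl
sum<-0 (suc n) e rewrite e 0 (s≤s z≤n) | sum<-0 n (λ j j<n → e (suc j) (s≤s j<n)) = refl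

sum<-+ : ∀ m n (f : ℕ → ℤ) → sum< (m + n) f ≡ sum< m f ℤ.+ sum< n (λ j → f (m + j))
sum<-+ zero    n f = sym (ℤ.+-identityˡ _)
sum<-+ (suc m) n f = trans (cong (ℤ._+_ (f 0)) (sum<-+ m n (f ∘ suc))) (sym (ℤ.+-assoc (f 0) _ _))

div-term : ℕ → Series → ℕ → ℕ → ℤ
div-term d s k j = shift (d * j) s k

mul-div : ∀ d → 1 ≤ d → ∀ s → mulOneMinus d (divOneMinus d s) ≐ s
mul-div d 1≤d s .at k = trans (cong (ℤ._- shift d (divOneMinus d s) k)
    (trans (sumℤ-upTo (suc k) (div-term d s k))
      (cong₂ ℤ._+_ (cong (λ z → shift z s k) (ℕ.*-zeroʳ d)) tail)))
  (solve 2 (λ a b → (a :+ b) :- b := a) refl (s k) (shift d (divOneMinus d s) k))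
  where
  tail : sum< k (div-term d s k ∘ suc) ≡ shift d (divOneMinus d s) k
  tail with ℕ.<-≤-connex k d
  ... | inj₁ k<d = trans
    (sum<-0 k (λ j _ → shift-< s (ℕ.<-≤-trans k<d (ℕ.m≤m*n d (suc j)))))
    (sym (shift-< (divOneMinus d s) k<d))
  ... | inj₂ d≤k = trans
    (sum<-cong k {g = div-term d s (k ∸ d)} λ j _ →
      trans (shift-index s (ℕ.*-suc d j) .at k)
        (trans (sym (shift-shift d (d * j) s .at k)) (shift-≥ (shift (d * j) s) d≤k)))
    -- After j = 0 is split off, k terms remain, whereas the quotient at k ∸ d has k ∸ d + 1 of
    -- them; the d ∸ 1 surplus terms shift by more than k ∸ d and vanish.
    (trans (cong (λ z → sum< z (div-term d s (k ∸ d))) (sym k≡))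
      (trans (sum<-+ (suc (k ∸ d)) (d ∸ 1) (div-term d s (k ∸ d)))
        (trans (cong (ℤ._+_ (sum< (suc (k ∸ d)) (div-term d s (k ∸ d)))) (sum<-0 (d ∸ 1) late))
          (trans (ℤ.+-identityʳ _)
            (trans (sym (sumℤ-upTo (suc (k ∸ d)) (div-term d s (k ∸ d))))
              (sym (shift-≥ (divOneMinus d s) d≤k)))))))
    where
    k≡ : suc (k ∸ d) + (d ∸ 1) ≡ k
    k≡ = trans (sym (ℕ.+-suc (k ∸ d) (d ∸ 1)))
      (trans (cong (_+_ (k ∸ d)) (ℕ.m+[n∸m]≡n 1≤d)) (ℕ.m∸n+n≡m d≤k))
    late : ∀ j → j < d ∸ 1 → div-term d s (k ∸ d) (suc (k ∸ d) + j) ≡ + 0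
    late j _ = shift-< s (ℕ.<-≤-trans (s≤s (ℕ.m≤m+n (k ∸ d) j))
      (ℕ.≤-trans (ℕ.≤-reflexive (sym (ℕ.*-identityˡ _))) (ℕ.*-monoˡ-≤ _ 1≤d)))

div-unique : ∀ d → 1 ≤ d → ∀ {s t} → mulOneMinus d t ≐ s → t ≐ divOneMinus d s
div-unique d 1≤d {s} e = mul-injective d 1≤d (≐-trans e (≐-sym (mul-div d 1≤d s)))

div-cong : ∀ d → 1 ≤ d → ∀ {s t} → s ≐ t → divOneMinus d s ≐ divOneMinus d t
div-cong d 1≤d {s} e = div-unique d 1≤d (≐-trans (mul-div d 1≤d s) e)

mul-div-comm : ∀ d e → 1 ≤ d → 1 ≤ e → ∀ s →
  mulOneMinus d (divOneMinus e s) ≐ divOneMinus e (mulOneMinus d s)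
mul-div-comm d e 1≤d 1≤e s = div-unique e 1≤e
  (≐-trans (mul-comm e d (divOneMinus e s)) (mul-cong d (mul-div e 1≤e s)))

div-comm : ∀ d e → 1 ≤ d → 1 ≤ e → ∀ s →
  divOneMinus d (divOneMinus e s) ≐ divOneMinus e (divOneMinus d s)
div-comm d e 1≤d 1≤e s = div-unique e 1≤e
  (≐-trans (mul-div-comm e d 1≤e 1≤d (divOneMinus e s)) (div-cong d 1≤d (mul-div e 1≤e s)))

-- Commutation of the factors 1 - x^d and their inverses

record Regular (f : Series → Series) : Set where
  field
    cong-≐ : ∀ {s t} → s ≐ t → f s ≐ f t
open Regular

Commute : (f g : Series → Series) → Set
Commute f g = ∀ s → f (g s) ≐ g (f s)

iter-cong : ∀ n {f} → Regular f → Regular (iter n f)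
iter-cong zero    r .cong-≐ e = e
iter-cong (suc n) r .cong-≐ e = r .cong-≐ (iter-cong n r .cong-≐ e)

iter-comm : ∀ n {f g} → Regular f → Commute f g → Commute (iter n f) g
iter-comm zero    r c s = ≐-refl
iter-comm (suc n) r c s = ≐-trans (r .cong-≐ (iter-comm n r c s)) (c _)

commute-sym : ∀ {f g} → Commute f g → Commute g f
commute-sym c s = ≐-sym (c s)

mul-regular : ∀ d → Regular (mulOneMinus d)
mul-regular d .cong-≐ = mul-cong d

div-regular : ∀ d → 1 ≤ d → Regular (divOneMinus d)
div-regular d 1≤d .cong-≐ = div-cong d 1≤d

mulPow-regular : ∀ d z → 1 ≤ d → Regular (mulPow d z)
mulPow-regular d (+ n)    1≤d .cong-≐ = iter-cong n (mul-regular d) .cong-≐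
mulPow-regular d -[1+ n ] 1≤d .cong-≐ = iter-cong (suc n) (div-regular d 1≤d) .cong-≐

mulPow-comm : ∀ d e z w → 1 ≤ d → 1 ≤ e → Commute (mulPow d z) (mulPow e w)
mulPow-comm d e (+ m) (+ n) 1≤d 1≤e = iter-comm m (mul-regular d)
  (commute-sym {iter n (mulOneMinus e)} (iter-comm n (mul-regular e) (mul-comm e d)))
mulPow-comm d e (+ m) -[1+ n ] 1≤d 1≤e = iter-comm m (mul-regular d)
  (commute-sym {iter (suc n) (divOneMinus e)} (iter-comm (suc n) (div-regular e 1≤e)
    (commute-sym {mulOneMinus d} {divOneMinus e} (mul-div-comm d e 1≤d 1≤e))))
mulPow-comm d e -[1+ m ] (+ n) 1≤d 1≤e = iter-comm (suc m) (div-regular d 1≤d)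
  (commute-sym {iter n (mulOneMinus e)} (iter-comm n (mul-regular e) (mul-div-comm e d 1≤e 1≤d)))
mulPow-comm d e -[1+ m ] -[1+ n ] 1≤d 1≤e = iter-comm (suc m) (div-regular d 1≤d)
  (commute-sym {iter (suc n) (divOneMinus e)} (iter-comm (suc n) (div-regular e 1≤e) (div-comm e d 1≤e 1≤d)))

-- The order in which filtering lists the divisors depends on the sizes of p, q, r and their
-- products; commutation makes it irrelevant.
foldr-↭ : (op : ℕ → Series → Series) → (∀ d → Regular (op d)) → (∀ d e → Commute (op d) (op e)) →
  ∀ {s xs ys} → xs ↭ ys → foldr op s xs ≐ foldr op s ys
foldr-↭ op r c Perm.refl = ≐-refl
foldr-↭ op r c (Perm.prep x π) = r x .cong-≐ (foldr-↭ op r c π)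
foldr-↭ op r c (Perm.swap x y π) = ≐-trans (c x y _) (r y .cong-≐ (r x .cong-≐ (foldr-↭ op r c π)))
foldr-↭ op r c (Perm.trans π ρ) = ≐-trans (foldr-↭ op r c π) (foldr-↭ op r c ρ)

-- The power series of Φ_pqr

sum<-- : ∀ n (f g : ℕ → ℤ) → sum< n (λ x → f x ℤ.- g x) ≡ sum< n f ℤ.- sum< n g
sum<-- zero    f g = refl
sum<-- (suc n) f g rewrite sum<-- n (f ∘ suc) (g ∘ suc) =
  solve 4 (λ a b c e → (a :- b) :+ (c :- e) := (a :+ c) :- (b :+ e)) refl
    (f 0) (g 0) (sum< n (f ∘ suc)) (sum< n (g ∘ suc))

sum<-telescope : ∀ n (f : ℕ → ℤ) → sum< n f ℤ.- sum< n (f ∘ suc) ≡ f 0 ℤ.- f n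
sum<-telescope zero    f = sym (ℤ.+-inverseʳ (f 0))
sum<-telescope (suc n) f = trans
  (solve 4 (λ a b c e → (a :+ b) :- (c :+ e) := (a :- c) :+ (b :- e)) refl
    (f 0) (sum< n (f ∘ suc)) (f 1) (sum< n (f ∘ suc ∘ suc)))
  (trans (cong (ℤ._+_ (f 0 ℤ.- f 1)) (sum<-telescope n (f ∘ suc)))
    (solve 3 (λ a b c → (a :- b) :+ (b :- c) := a :- c) refl (f 0) (f 1) (f (suc n))))

-- s · (1 + x^d + … + x^(d(n−1)))
geom : ℕ → ℕ → Series → Series
geom n d s k = sum< n (λ x → shift (d * x) s k)

shift-sum< : ∀ e n (t : ℕ → Series) →
  shift e (λ k → sum< n (λ x → t x k)) ≐ (λ k → sum< n (λ x → shift e (t x) k))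
shift-sum< e n t .at k with e ≤ᵇ k
... | true  = refl
... | false = sym (sum<-0 n (λ _ _ → refl))

geom-cong : ∀ n d {s t} → s ≐ t → geom n d s ≐ geom n d t
geom-cong n d e .at k = sum<-cong n (λ x _ → shift-cong (d * x) e .at k)

shift-geom : ∀ e n d s → shift e (geom n d s) ≐ geom n d (shift e s)
shift-geom e n d s .at k = trans (shift-sum< e n (λ x → shift (d * x) s) .at k)
  (sum<-cong n (λ x _ → shift-comm e (d * x) s .at k))

mul-geom-comm : ∀ e n d s → mulOneMinus e (geom n d s) ≐ geom n d (mulOneMinus e s)
mul-geom-comm e n d s .at k = trans
  (cong (ℤ._-_ (geom n d s k)) (shift-geom e n d s .at k))
  (trans (sym (sum<-- n (λ x → shift (d * x) s k) (λ x → shift (d * x) (shift e s) k)))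
    (sum<-cong n (λ x _ → sym (shift-⊖ (d * x) s (shift e s) .at k))))

mul-geom : ∀ n d s → mulOneMinus d (geom n d s) ≐ mulOneMinus (d * n) s
mul-geom n d s .at k = trans
  (cong (ℤ._-_ (geom n d s k)) (trans (shift-sum< d n (λ x → shift (d * x) s) .at k)
    (sum<-cong n (λ x _ → trans (shift-shift d (d * x) s .at k)
      (shift-index s (sym (ℕ.*-suc d x)) .at k)))))
  (trans (sum<-telescope n (λ x → shift (d * x) s k))
    (cong (ℤ._- shift (d * n) s k) (shift-index s (ℕ.*-zeroʳ d) .at k)))

mul-mul : ∀ d e s k → mulOneMinus d (mulOneMinus e s) k ≡
  (s k ℤ.- shift e s k) ℤ.- (shift d s k ℤ.- shift (d + e) s k)
mul-mul d e s k = cong (ℤ._-_ (s k ℤ.- shift e s k))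
  (trans (shift-⊖ d s (shift e s) .at k) (cong (ℤ._-_ (shift d s k)) (shift-shift d e s .at k)))

mul-mul-geom-geom : ∀ d e m n s →
  mulOneMinus d (mulOneMinus e (geom m d (geom n e s))) ≐ mulOneMinus (d * m) (mulOneMinus (e * n) s)
mul-mul-geom-geom d e m n s =
  ≐-trans (mul-cong d (mul-geom-comm e m d (geom n e s)))
  (≐-trans (mul-geom m d (mulOneMinus e (geom n e s)))
  (mul-cong (d * m) (mul-geom n e s)))

-- Multiplication by Φ_pq(x^r) when P = rp, Q = rq:  with m·p + n·q = pq + 1,
--   Φ_pq(x) = Σ_{i<m, j<n} x^(ip+jq) − x · Σ_{i<m′, j<n′} x^(ip+jq),   m′ = q − m,  n′ = p − n.
binary : (r P Q m n m′ n′ : ℕ) → Series → Series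
binary r P Q m n m′ n′ s = geom m P (geom n Q s) ⊖ shift r (geom m′ P (geom n′ Q s))

mul-binary : ∀ e r P Q m n m′ n′ s →
  mulOneMinus e (binary r P Q m n m′ n′ s) ≐ binary r P Q m n m′ n′ (mulOneMinus e s)
mul-binary e r P Q m n m′ n′ s =
  ≐-trans (mul-⊖ e (geom m P (geom n Q s)) (shift r (geom m′ P (geom n′ Q s))))
  (⊖-cong (past m n)
    (≐-trans (≐-sym (shift-mul r e (geom m′ P (geom n′ Q s)))) (shift-cong r (past m′ n′))))
  where
  past : ∀ m n → mulOneMinus e (geom m P (geom n Q s)) ≐ geom m P (geom n Q (mulOneMinus e s))
  past m n = ≐-trans (mul-geom-comm e m P (geom n Q s)) (geom-cong m P (mul-geom-comm e n Q s))

binary-cong : ∀ r P Q m n m′ n′ {s t} → s ≐ t → binary r P Q m n m′ n′ s ≐ binary r P Q m n m′ n′ t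
binary-cong r P Q m n m′ n′ e =
  ⊖-cong (geom-cong m P (geom-cong n Q e)) (shift-cong r (geom-cong m′ P (geom-cong n′ Q e)))

-- Both double sums telescope to four terms each. By the second and third hypothesis the terms
-- x^(Pm) and x^(Qn) cancel between them; by the first and fourth the rest is (1 - x^r)(1 - x^E).
-- With E = rpq this is the quotient formula for Φ_pq(x^r).
binary-identity : ∀ r P Q m n m′ n′ E s →
  P * m + Q * n ≡ r + E → r + P * m′ ≡ Q * n → r + Q * n′ ≡ P * m → Q * n + Q * n′ ≡ E →
  mulOneMinus P (mulOneMinus Q (binary r P Q m n m′ n′ s)) ≐ mulOneMinus r (mulOneMinus E s)
binary-identity r P Q m n m′ n′ E s h₁ h₂ h₃ h₄ =
  ≐-trans (mul-cong P (mul-⊖ Q u (shift r v)))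
  (≐-trans (mul-⊖ P (mulOneMinus Q u) (mulOneMinus Q (shift r v)))
  (≐-trans (⊖-cong (mul-mul-geom-geom P Q m n s)
    (≐-trans (mul-cong P (≐-sym (shift-mul r Q v)))
      (≐-trans (≐-sym (shift-mul r P (mulOneMinus Q v)))
        (shift-cong r (mul-mul-geom-geom P Q m′ n′ s)))))
  (pointwise expand)))
  where
  u v : Series
  u = geom m P (geom n Q s)
  v = geom m′ P (geom n′ Q s)
  X Y X′ Y′ : ℕ
  X  = P * m
  Y  = Q * n
  X′ = P * m′
  Y′ = Q * n′
  σ : ℕ → ℕ → ℤ
  σ k e = shift e s k
  shifted : ∀ k → shift r (mulOneMinus X′ (mulOneMinus Y′ s)) k ≡
    (σ k r ℤ.- σ k X) ℤ.- (σ k Y ℤ.- σ k E)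
  shifted k = trans
    (trans (shift-mul r X′ (mulOneMinus Y′ s) .at k)
      (trans (mul-cong X′ (shift-mul r Y′ s) .at k) (mul-mul X′ Y′ (shift r s) k)))
    (cong₂ ℤ._-_
      (cong (ℤ._-_ (σ k r)) (trans (shift-shift Y′ r s .at k)
        (cong (σ k) (trans (ℕ.+-comm Y′ r) h₃))))
      (cong₂ ℤ._-_
        (trans (shift-shift X′ r s .at k) (cong (σ k) (trans (ℕ.+-comm X′ r) h₂)))
        (trans (shift-shift (X′ + Y′) r s .at k) (cong (σ k)
          (trans (ℕ.+-comm (X′ + Y′) r) (trans (sym (ℕ.+-assoc r X′ Y′))
            (trans (cong (λ z → z + Y′) h₂) h₄)))))))
  expand : ∀ k → (mulOneMinus X (mulOneMinus Y s) ⊖ shift r (mulOneMinus X′ (mulOneMinus Y′ s))) k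
    ≡ mulOneMinus r (mulOneMinus E s) k
  expand k = trans (cong₂ ℤ._-_ (mul-mul X Y s k) (shifted k))
    (trans (cong (λ z → ((s k ℤ.- σ k Y) ℤ.- (σ k X ℤ.- z)) ℤ.- ((σ k r ℤ.- σ k X) ℤ.- (σ k Y ℤ.- σ k E)))
        (cong (σ k) h₁))
    (trans (solve 6 (λ s b a e r t → ((s :- b) :- (a :- t)) :- ((r :- a) :- (b :- e)) := (s :- e) :- (r :- t)) refl
      (s k) (σ k Y) (σ k X) (σ k E) (σ k r) (σ k (r + E)))
    (sym (mul-mul r E s k))))

indicator : Bool → ℤ
indicator b = if b then + 1 else + 0

-- The series 1/(1 - x^n) in closed form, so that coefficients of products with it become congruence
-- conditions.
multiples : ℕ → Series
multiples n k = indicator ⌊ n ∣? k ⌋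

multiples-yes : ∀ {n k} → n ∣ k → multiples n k ≡ + 1
multiples-yes {n} {k} n∣k with n ∣? k
... | yes _ = refl
... | no ¬d = ⊥-elim (¬d n∣k)

multiples-no : ∀ {n k} → ¬ n ∣ k → multiples n k ≡ + 0
multiples-no {n} {k} ¬d with n ∣? k
... | yes d = ⊥-elim (¬d d)
... | no _  = refl

mul-multiples : ∀ n → 1 ≤ n → mulOneMinus n (multiples n) ≐ oneS
mul-multiples n 1≤n .at k with ℕ.<-≤-connex k n
mul-multiples n 1≤n .at zero    | inj₁ k<n
  rewrite shift-< (multiples n) k<n | multiples-yes (n ∣0) = refl
mul-multiples n 1≤n .at (suc k) | inj₁ k<n
  rewrite shift-< (multiples n) k<n | multiples-no (>⇒∤ k<n) = refl
... | inj₂ n≤k rewrite shift-≥ (multiples n) n≤k = difference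
  where
  n+ : n + (k ∸ n) ≡ k
  n+ = ℕ.m+[n∸m]≡n n≤k
  oneS-positive : ∀ {j} → 1 ≤ j → oneS j ≡ + 0
  oneS-positive (s≤s _) = refl
  one : oneS k ≡ + 0
  one = oneS-positive (ℕ.≤-trans 1≤n n≤k)
  difference : multiples n k ℤ.- multiples n (k ∸ n) ≡ oneS k
  difference with n ∣? k
  ... | yes d rewrite one | multiples-yes (∣m+n∣m⇒∣n (subst (n ∣_) (sym n+) d) (∣-refl {n})) = refl
  ... | no ¬d rewrite one
      | multiples-no (λ d → ¬d (subst (n ∣_) n+ (∣m∣n⇒∣m+n (∣-refl {n}) d))) = refl

ternary : (p q r m n m′ n′ : ℕ) → Series
ternary p q r m n m′ n′ =
  geom p 1 (mulOneMinus q (binary r (r * p) (r * q) m n m′ n′ (multiples (p * q))))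

-- Each of the four divisions is undone in turn: the factor for 1 collapses the geometric sum to 1 -
-- x^p, the one for pq turns `multiples` into 1, and those for rp and rq are absorbed by
-- `binary-identity`.
ternary-unique : ∀ p q r m n m′ n′ → 1 ≤ p → 1 ≤ q → 1 ≤ r →
  p * m + q * n ≡ 1 + p * q → m + m′ ≡ q → n + n′ ≡ p →
  ternary p q r m n m′ n′ ≐
    divOneMinus 1 (divOneMinus (p * q) (divOneMinus (r * p) (divOneMinus (r * q)
      (mulOneMinus p (mulOneMinus q (mulOneMinus r (mulOneMinus (r * (p * q)) oneS)))))))
ternary-unique p q r m n m′ n′ 1≤p 1≤q 1≤r bez hm hn =
  div-unique 1 (s≤s z≤n) (div-unique (p * q) 1≤pq (div-unique (r * p) 1≤rp (div-unique (r * q) 1≤rq all)))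
  where
  1≤pq : 1 ≤ p * q
  1≤pq = ℕ.*-mono-≤ 1≤p 1≤q
  1≤rp : 1 ≤ r * p
  1≤rp = ℕ.*-mono-≤ 1≤r 1≤p
  1≤rq : 1 ≤ r * q
  1≤rq = ℕ.*-mono-≤ 1≤r 1≤q
  D : ℕ → Series → Series
  D = mulOneMinus
  H : Series → Series
  H = binary r (r * p) (r * q) m n m′ n′
  M : Series
  M = multiples (p * q)
  past₂ : ∀ d s → D d (D p (D q s)) ≐ D p (D q (D d s))
  past₂ d s = ≐-trans (mul-comm d p (D q s)) (mul-cong p (mul-comm d q s))
  open ≡-Reasoning
  rE : r * p * m + r * q * n ≡ r + r * (p * q)
  rE = begin
    r * p * m + r * q * n       ≡⟨ cong₂ _+_ (ℕ.*-assoc r p m) (ℕ.*-assoc r q n) ⟩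
    r * (p * m) + r * (q * n)   ≡⟨ ℕ.*-distribˡ-+ r (p * m) (q * n) ⟨
    r * (p * m + q * n)         ≡⟨ cong (r *_) bez ⟩
    r * (1 + p * q)             ≡⟨ ℕ.*-suc r (p * q) ⟩
    r + r * (p * q) ∎
  rq-split : r * q * n + r * q * n′ ≡ r * (p * q)
  rq-split = begin
    r * q * n + r * q * n′  ≡⟨ ℕ.*-distribˡ-+ (r * q) n n′ ⟨
    r * q * (n + n′)        ≡⟨ cong (r * q *_) hn ⟩
    r * q * p               ≡⟨ ℕ.*-assoc r q p ⟩
    r * (q * p)             ≡⟨ cong (r *_) (ℕ.*-comm q p) ⟩
    r * (p * q) ∎
  rp-split : r * p * m + r * p * m′ ≡ r * (p * q)
  rp-split = begin
    r * p * m + r * p * m′  ≡⟨ ℕ.*-distribˡ-+ (r * p) m m′ ⟨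
    r * p * (m + m′)        ≡⟨ cong (r * p *_) hm ⟩
    r * p * q               ≡⟨ ℕ.*-assoc r p q ⟩
    r * (p * q) ∎
  h₂ : r + r * p * m′ ≡ r * q * n
  h₂ = ℕ.+-cancelˡ-≡ (r * p * m) _ _ (begin
    r * p * m + (r + r * p * m′)  ≡⟨ cong (_+_ (r * p * m)) (ℕ.+-comm r (r * p * m′)) ⟩
    r * p * m + (r * p * m′ + r)  ≡⟨ ℕ.+-assoc (r * p * m) (r * p * m′) r ⟨
    r * p * m + r * p * m′ + r    ≡⟨ cong (λ z → z + r) rp-split ⟩
    r * (p * q) + r               ≡⟨ ℕ.+-comm (r * (p * q)) r ⟩
    r + r * (p * q)               ≡⟨ rE ⟨
    r * p * m + r * q * n ∎)
  h₃ : r + r * q * n′ ≡ r * p * m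
  h₃ = ℕ.+-cancelʳ-≡ (r * q * n) _ _ (begin
    r + r * q * n′ + r * q * n    ≡⟨ ℕ.+-assoc r (r * q * n′) (r * q * n) ⟩
    r + (r * q * n′ + r * q * n)  ≡⟨ cong (_+_ r) (trans (ℕ.+-comm (r * q * n′) (r * q * n)) rq-split) ⟩
    r + r * (p * q)               ≡⟨ rE ⟨
    r * p * m + r * q * n ∎)
  all : D (r * q) (D (r * p) (D (p * q) (D 1 (ternary p q r m n m′ n′)))) ≐
        D p (D q (D r (D (r * (p * q)) oneS)))
  all =
    ≐-trans (mul-cong (r * q) (mul-cong (r * p)
      (≐-trans (mul-cong (p * q) (≐-trans (mul-geom p 1 (D q (H M)))
        (pointwise λ k → cong (λ z → D z (D q (H M)) k) (ℕ.*-identityˡ p))))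
      (≐-trans (past₂ (p * q) (H M))
        (mul-cong p (mul-cong q (≐-trans (mul-binary (p * q) r (r * p) (r * q) m n m′ n′ M)
          (binary-cong r (r * p) (r * q) m n m′ n′ (mul-multiples (p * q) 1≤pq)))))))))
    (≐-trans (mul-comm (r * q) (r * p) (D p (D q (H oneS))))
    (≐-trans (mul-cong (r * p) (past₂ (r * q) (H oneS)))
    (≐-trans (past₂ (r * p) (D (r * q) (H oneS)))
      (mul-cong p (mul-cong q
        (binary-identity r (r * p) (r * q) m n m′ n′ (r * (p * q)) oneS rE h₂ h₃ rq-split))))))

ternary-coefficient : ∀ p q r m n m′ n′ k → ternary p q r m n m′ n′ k ≡
  sum< p (λ i → shift i (binary r (r * p) (r * q) m n m′ n′ (multiples (p * q))) k ℤ.-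
                shift (i + q) (binary r (r * p) (r * q) m n m′ n′ (multiples (p * q))) k)
ternary-coefficient p q r m n m′ n′ k = sum<-cong p λ i _ →
  trans (cong (λ z → shift z (mulOneMinus q B) k) (ℕ.*-identityˡ i))
  (trans (shift-⊖ i B (shift q B) .at k) (cong (ℤ._-_ (shift i B k)) (shift-shift i q B .at k)))
  where
  B : Series
  B = binary r (r * p) (r * q) m n m′ n′ (multiples (p * q))

shift-binary : ∀ j r P Q m n m′ n′ s k → shift j (binary r P Q m n m′ n′ s) k ≡
  sum< m (λ x → sum< n (λ y → shift (j + (P * x + Q * y)) s k)) ℤ.-
  sum< m′ (λ x → sum< n′ (λ y → shift (j + (r + (P * x + Q * y))) s k))
shift-binary j r P Q m n m′ n′ s k =
  trans (shift-⊖ j (geom m P (geom n Q s)) (shift r (geom m′ P (geom n′ Q s))) .at k)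
  (cong₂ ℤ._-_ (double j m n)
    (trans (shift-shift j r (geom m′ P (geom n′ Q s)) .at k)
      (trans (double (j + r) m′ n′)
        (sum<-cong m′ λ x _ → sum<-cong n′ λ y _ →
          shift-index s (ℕ.+-assoc j r (P * x + Q * y)) .at k))))
  where
  double : ∀ j m n → shift j (geom m P (geom n Q s)) k ≡
    sum< m (λ x → sum< n (λ y → shift (j + (P * x + Q * y)) s k))
  double j m n = trans (shift-sum< j m (λ x → shift (P * x) (geom n Q s)) .at k)
    (sum<-cong m λ x _ →
      trans (shift-shift j (P * x) (geom n Q s) .at k)
      (trans (shift-sum< (j + P * x) n (λ y → shift (Q * y) s) .at k)
      (sum<-cong n λ y _ →
        trans (shift-shift (j + P * x) (Q * y) s .at k)
          (shift-index s (ℕ.+-assoc j (P * x) (Q * y)) .at k))))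

unique-↭ : ∀ {X : Set} {xs ys : List X} → Unique xs → Unique ys →
  (∀ {x} → x ∈ xs → x ∈ ys) → (∀ {x} → x ∈ ys → x ∈ xs) → xs ↭ ys
unique-↭ u v f g = ∼bag⇒↭ (unique∧set⇒bag u v (mk⇔ f g))

-- Products of distinct primes

prime>1 : ∀ {p} → Prime p → 1 < p
prime>1 {p} pp = nonTrivial⇒n>1 p {{prime⇒nonTrivial pp}}

prime>0 : ∀ {p} → Prime p → 1 ≤ p
prime>0 pp = ℕ.<⇒≤ (prime>1 pp)

prime-coprime : ∀ {p d} → Prime p → ¬ p ∣ d → Coprime d p
prime-coprime pp p∤d (i∣d , i∣p) with prime⇒irreducible pp i∣p
... | inj₁ i≡1  = i≡1
... | inj₂ refl = contradiction i∣d p∤d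

∣-prime* : ∀ {p d m} → Prime p → d ∣ p * m → d ∣ m ⊎ ∃ λ e → d ≡ p * e × e ∣ m
∣-prime* {p} {d} {m} pp d∣pm with p ∣? d
... | no p∤d = inj₁ (coprime-divisor (prime-coprime pp p∤d) d∣pm)
... | yes (divides e refl) = inj₂ (e , ℕ.*-comm e p ,
  *-cancelˡ-∣ p {{prime⇒nonZero pp}} (subst (_∣ p * m) (ℕ.*-comm e p) d∣pm))

Primes : List ℕ → Set
Primes = All Prime

product>0 : ∀ {ps} → Primes ps → 1 ≤ product ps
product>0 = productOfPrimes≥1

prime∤product : ∀ {p ps} → Primes (p ∷ ps) → Unique (p ∷ ps) → ¬ p ∣ product ps
prime∤product (pp ∷ pps) u d = Unique[x∷xs]⇒x∉xs u (factorisationHasAllPrimeFactors pp d pps)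

prime-factor : ∀ {ps g} → Primes ps → g ∣ product ps → g ≢ 1 → ∃ λ p → p ∈ ps × p ∣ g
prime-factor [] g∣1 g≢1 = contradiction (∣1⇒≡1 g∣1) g≢1
prime-factor (pp ∷ pps) g∣ g≢1 with ∣-prime* pp g∣
... | inj₁ g∣′ = let s , s∈ , s∣g = prime-factor pps g∣′ g≢1 in s , there s∈ , s∣g
... | inj₂ (e , refl , _) = _ , here refl , m∣m*n e

-- If the first prime p divides e · e, it divides e, so p · p divides the product and p divides the
-- product of the other primes, which is impossible. Otherwise e · e already divides the smaller
-- product.
square∤product : ∀ {ps} → Primes ps → Unique ps → ∀ e → 1 < e → ¬ e * e ∣ product ps
square∤product [] u e 1<e d = ℕ.<⇒≢ 1<e (sym (ℕ.m*n≡1⇒m≡1 e e (∣1⇒≡1 d)))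
square∤product {p ∷ ps} (pp ∷ pps) u@(_ ∷ v) e 1<e d with ∣-prime* pp d
... | inj₁ d′ = square∤product pps v e 1<e d′
... | inj₂ (f , eq , _) with euclidsLemma e e pp (divides f (trans eq (ℕ.*-comm p f)))
...   | inj₁ p∣e = prime∤product (pp ∷ pps) u (*-cancelˡ-∣ p {{prime⇒nonZero pp}} (∣-trans (*-pres-∣ p∣e p∣e) d))
...   | inj₂ p∣e = prime∤product (pp ∷ pps) u (*-cancelˡ-∣ p {{prime⇒nonZero pp}} (∣-trans (*-pres-∣ p∣e p∣e) d))

divisorsOf : List ℕ → List ℕ
divisorsOf []       = 1 ∷ []
divisorsOf (p ∷ ps) = divisorsOf ps ++ map (p *_) (divisorsOf ps)

∈-divisorsOf⁻ : ∀ ps {d} → d ∈ divisorsOf ps → d ∣ product ps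
∈-divisorsOf⁻ [] (here refl) = ∣-refl
∈-divisorsOf⁻ (p ∷ ps) d∈ with ∈-++⁻ (divisorsOf ps) d∈
... | inj₁ d∈′ = ∣n⇒∣m*n p (∈-divisorsOf⁻ ps d∈′)
... | inj₂ d∈′ with ∈-map⁻ (p *_) d∈′
...   | e , e∈ , refl = *-monoʳ-∣ p (∈-divisorsOf⁻ ps e∈)

∈-divisorsOf⁺ : ∀ {ps d} → Primes ps → d ∣ product ps → d ∈ divisorsOf ps
∈-divisorsOf⁺ [] d∣ = here (∣1⇒≡1 d∣)
∈-divisorsOf⁺ {p ∷ ps} (pp ∷ pps) d∣ with ∣-prime* pp d∣
... | inj₁ d∣′ = ∈-++⁺ˡ (∈-divisorsOf⁺ pps d∣′)
... | inj₂ (e , refl , e∣) = ∈-++⁺ʳ (divisorsOf ps) (∈-map⁺ (p *_) (∈-divisorsOf⁺ pps e∣))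

divisorsOf-unique : ∀ {ps} → Primes ps → Unique ps → Unique (divisorsOf ps)
divisorsOf-unique [] u = [] ∷ []
divisorsOf-unique {p ∷ ps} (pp ∷ pps) u@(_ ∷ v) =
  Unique.++⁺ ih (Unique.map⁺ (ℕ.*-cancelˡ-≡ _ _ p {{prime⇒nonZero pp}}) ih) disjoint
  where
  ih : Unique (divisorsOf ps)
  ih = divisorsOf-unique pps v
  disjoint : ∀ {d} → ¬ (d ∈ divisorsOf ps × d ∈ map (p *_) (divisorsOf ps))
  disjoint (d∈ , d∈p) with ∈-map⁻ (p *_) d∈p
  ... | e , _ , refl = prime∤product (pp ∷ pps) u (∣-trans (m∣m*n e) (∈-divisorsOf⁻ ps d∈))

divisors⁻-↭ : ∀ {ps} → Primes ps → Unique ps → divisors⁻ (product ps) ↭ map pred (divisorsOf ps)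
divisors⁻-↭ {ps} pps u = unique-↭ (Unique.filter⁺ (λ d → suc d ∣? n) (Unique.upTo⁺ n))
  (map-pred-unique (divisorsOf-unique pps u) λ d∈ → d∈)
  to from
  where
  n : ℕ
  n = product ps
  positive : ∀ {d} → d ∈ divisorsOf ps → ∃ λ e → d ≡ suc e
  positive {zero} d∈ = contradiction (0∣⇒≡0 (∈-divisorsOf⁻ ps d∈)) (ℕ.>⇒≢ (product>0 pps))
  positive {suc e} _ = e , refl
  map-pred-unique : ∀ {xs} → Unique xs → (∀ {x} → x ∈ xs → x ∈ divisorsOf ps) → Unique (map pred xs)
  map-pred-unique [] _ = []
  map-pred-unique {x ∷ xs} (x∉ ∷ u) inc =
    All.tabulate distinct ∷ map-pred-unique u (inc ∘ there)
    where
    distinct : ∀ {z} → z ∈ map pred xs → pred x ≢ z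
    distinct z∈ eq with ∈-map⁻ pred z∈
    ... | y , y∈ , refl with positive (inc (here refl)) | positive (inc (there y∈))
    ...   | e , refl | f , refl = All.lookup x∉ y∈ (cong suc eq)
  to : ∀ {d} → d ∈ divisors⁻ n → d ∈ map pred (divisorsOf ps)
  to d∈ = ∈-map⁺ pred (∈-divisorsOf⁺ pps (proj₂ (∈-filter⁻ (λ d → suc d ∣? n) {xs = upTo n} d∈)))
  from : ∀ {d} → d ∈ map pred (divisorsOf ps) → d ∈ divisors⁻ n
  from d∈ with ∈-map⁻ pred d∈
  ... | x , x∈ , refl with positive x∈
  ...   | e , refl = ∈-filter⁺ (λ d → suc d ∣? n)
    (∈-upTo⁺ (∣⇒≤ {{>-nonZero (product>0 pps)}} (∈-divisorsOf⁻ ps x∈))) (∈-divisorsOf⁻ ps x∈)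

allB-true : ∀ f xs → (∀ x → f x ≡ true) → allB f xs ≡ true
allB-true f [] h = refl
allB-true f (x ∷ xs) h rewrite h x | allB-true f xs h = refl

squarefree-product : ∀ {ps} → Primes ps → Unique ps → squarefree (product ps) ≡ true
squarefree-product {ps} pps u = allB-true _ (upTo (product ps)) free
  where
  free : ∀ d → not ⌊ suc (suc d) * suc (suc d) ∣? product ps ⌋ ≡ true
  free d with suc (suc d) * suc (suc d) ∣? product ps
  ... | yes e = contradiction e (square∤product pps u (suc (suc d)) (s≤s (s≤s z≤n)))
  ... | no _  = refl

ω-product : ∀ {ps} → Primes ps → Unique ps → ω (product ps) ≡ length ps
ω-product {ps} pps u = ↭-length (unique-↭
  (Unique.filter⁺ prime? (Unique.map⁺ ℕ.suc-injective (Unique.filter⁺ (λ d → suc d ∣? n) (Unique.upTo⁺ n))))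
  u to from)
  where
  n : ℕ
  n = product ps
  to : ∀ {d} → d ∈ filter prime? (divisors n) → d ∈ ps
  to d∈ with ∈-filter⁻ prime? {xs = divisors n} d∈
  ... | d∈′ , dp with ∈-map⁻ suc {xs = divisors⁻ n} d∈′
  ...   | e , e∈ , refl = factorisationHasAllPrimeFactors dp (proj₂ (∈-filter⁻ (λ d → suc d ∣? n) {xs = upTo n} e∈)) pps
  ∈⇒∣ : ∀ {d} (qs : List ℕ) → d ∈ qs → d ∣ product qs
  ∈⇒∣ (q ∷ qs) (here refl) = m∣m*n (product qs)
  ∈⇒∣ (q ∷ qs) (there d∈)  = ∣n⇒∣m*n q (∈⇒∣ qs d∈)
  from : ∀ {d} → d ∈ ps → d ∈ filter prime? (divisors n)
  from {zero} d∈ = contradiction (All.lookup pps d∈) ¬prime[0]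
  from {suc d} d∈ = ∈-filter⁺ prime? (∈-map⁺ suc (∈-filter⁺ (λ d → suc d ∣? n)
    (∈-upTo⁺ (∣⇒≤ {{>-nonZero (product>0 pps)}} (∈⇒∣ ps d∈))) (∈⇒∣ ps d∈))) (All.lookup pps d∈)

parity : ℕ → ℤ
parity k = if (k % 2) ≡ᵇ 0 then + 1 else ℤ.- (+ 1)

μ-positive : ∀ {n} → 1 ≤ n → μ n ≡ (if squarefree n then parity (ω n) else + 0)
μ-positive (s≤s _) = refl

μ-product : ∀ {ps} → Primes ps → Unique ps → μ (product ps) ≡ parity (length ps)
μ-product {ps} pps u = trans (μ-positive (product>0 pps))
  (trans (cong (λ b → if b then parity (ω (product ps)) else + 0) (squarefree-product pps u))
    (cong parity (ω-product pps u)))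

μ-quotient : ∀ {ds n cs} → .{{_ : NonZero ds}} → Primes cs → Unique cs → product cs * ds ≡ n →
  μ (n / ds) ≡ parity (length cs)
μ-quotient {ds} {cs = cs} pcs u refl = trans (cong μ (m*n/n≡m (product cs) ds)) (μ-product pcs u)

module Ternary {p q r : ℕ} (pp : Prime p) (pq : Prime q) (pr : Prime r) (p<q : p < q) (q<r : q < r) where

  private
    ps : List ℕ
    ps = p ∷ q ∷ r ∷ []
    N : ℕ
    N = product ps

    op : ℕ → Series → Series
    op d s = mulPow (suc d) (μ (N / suc d)) s

    p≢q : p ≢ q
    p≢q = ℕ.<⇒≢ p<q
    q≢r : q ≢ r
    q≢r = ℕ.<⇒≢ q<r
    p≢r : p ≢ r
    p≢r = ℕ.<⇒≢ (ℕ.<-trans p<q q<r)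

    distinct : Unique ps
    distinct = (p≢q ∷ p≢r ∷ []) ∷ (q≢r ∷ []) ∷ [] ∷ []

    -- The divisors with an odd number of complementary primes come before the others. As μ is -1 on
    -- their complements, the fold has its four divisions outside and its four multiplications
    -- inside.
    reorder : divisorsOf ps ↭
      1 ∷ p * (q * 1) ∷ p * (r * 1) ∷ q * (r * 1) ∷ p * 1 ∷ q * 1 ∷ r * 1 ∷ p * (q * (r * 1)) ∷ []
    reorder = Perm.prep 1
      (Perm.trans (Perm.shift (p * (q * 1)) (r * 1 ∷ q * 1 ∷ q * (r * 1) ∷ p * 1 ∷ p * (r * 1) ∷ []) _) (Perm.prep _
      (Perm.trans (Perm.shift (p * (r * 1)) (r * 1 ∷ q * 1 ∷ q * (r * 1) ∷ p * 1 ∷ []) _) (Perm.prep _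
      (Perm.trans (Perm.shift (q * (r * 1)) (r * 1 ∷ q * 1 ∷ []) _) (Perm.prep _
      (Perm.trans (Perm.shift (p * 1) (r * 1 ∷ q * 1 ∷ []) _) (Perm.prep _
      (Perm.swap _ _ Perm.refl)))))))))

    op-step : ∀ {x x′ cs s t} → 1 ≤ x → Primes cs → Unique cs → product cs * x ≡ N → x ≡ x′ →
      s ≐ t → op (pred x) s ≐ mulPow x′ (parity (length cs)) t
    op-step {suc x} {cs = cs} {s} {t} 1≤x pcs u eq refl s≐t = ≐-trans
      (pointwise λ k → cong (λ z → mulPow (suc x) z s k) (μ-quotient {suc x} pcs u eq))
      (mulPow-regular (suc x) (parity (length cs)) (s≤s z≤n) .Regular.cong-≐ s≐t)

    1≤* : ∀ {x y} → 1 ≤ x → 1 ≤ y → 1 ≤ x * y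
    1≤* = ℕ.*-mono-≤

    1≤p : 1 ≤ p
    1≤p = prime>0 pp
    1≤q : 1 ≤ q
    1≤q = prime>0 pq
    1≤r : 1 ≤ r
    1≤r = prime>0 pr
    1≤1 : 1 ≤ 1
    1≤1 = s≤s z≤n

  cycSeries-factors : cycSeries (p * q * r) ≐
    divOneMinus 1 (divOneMinus (p * q) (divOneMinus (r * p) (divOneMinus (r * q)
      (mulOneMinus p (mulOneMinus q (mulOneMinus r (mulOneMinus (r * (p * q)) oneS)))))))
  cycSeries-factors = ≐-trans (pointwise λ k → cong (λ z → cycSeries z k) (pqr p q r))
    (≐-trans (foldr-↭ op (λ d → mulPow-regular (suc d) (μ (N / suc d)) (s≤s z≤n))
        (λ d e → mulPow-comm (suc d) (suc e) (μ (N / suc d)) (μ (N / suc e)) (s≤s z≤n) (s≤s z≤n))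
        (Perm.trans (divisors⁻-↭ (pp ∷ pq ∷ pr ∷ []) distinct) (Perm.map⁺ pred reorder)))
    (op-step 1≤1 (pp ∷ pq ∷ pr ∷ []) distinct (e₁ p q r) refl
    (op-step (1≤* 1≤p (1≤* 1≤q 1≤1)) (pr ∷ []) ([] ∷ []) (e₂ p q r) (f₂ p q)
    (op-step (1≤* 1≤p (1≤* 1≤r 1≤1)) (pq ∷ []) ([] ∷ []) (e₃ p q r) (f₃ p r)
    (op-step (1≤* 1≤q (1≤* 1≤r 1≤1)) (pp ∷ []) ([] ∷ []) (e₄ p q r) (f₃ q r)
    (op-step (1≤* 1≤p 1≤1) (pq ∷ pr ∷ []) ((q≢r ∷ []) ∷ [] ∷ []) (e₅ p q r) (f₁ p)
    (op-step (1≤* 1≤q 1≤1) (pp ∷ pr ∷ []) ((p≢r ∷ []) ∷ [] ∷ []) (e₆ p q r) (f₁ q)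
    (op-step (1≤* 1≤r 1≤1) (pp ∷ pq ∷ []) ((p≢q ∷ []) ∷ [] ∷ []) (e₇ p q r) (f₁ r)
    (op-step (1≤* 1≤p (1≤* 1≤q (1≤* 1≤r 1≤1))) [] [] (e₈ p q r) (f₈ p q r)
      ≐-refl)))))))))
    where
    pqr : ∀ p q r → p * q * r ≡ p * (q * (r * 1))
    pqr = solve-∀
    e₁ : ∀ p q r → p * (q * (r * 1)) * 1 ≡ p * (q * (r * 1))
    e₁ = solve-∀
    e₂ : ∀ p q r → r * 1 * (p * (q * 1)) ≡ p * (q * (r * 1))
    e₂ = solve-∀
    e₃ : ∀ p q r → q * 1 * (p * (r * 1)) ≡ p * (q * (r * 1))
    e₃ = solve-∀
    e₄ : ∀ p q r → p * 1 * (q * (r * 1)) ≡ p * (q * (r * 1))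
    e₄ = solve-∀
    e₅ : ∀ p q r → q * (r * 1) * (p * 1) ≡ p * (q * (r * 1))
    e₅ = solve-∀
    e₆ : ∀ p q r → p * (r * 1) * (q * 1) ≡ p * (q * (r * 1))
    e₆ = solve-∀
    e₇ : ∀ p q r → p * (q * 1) * (r * 1) ≡ p * (q * (r * 1))
    e₇ = solve-∀
    e₈ : ∀ p q r → 1 * (p * (q * (r * 1))) ≡ p * (q * (r * 1))
    e₈ = solve-∀
    f₁ : ∀ p → p * 1 ≡ p
    f₁ = ℕ.*-identityʳ
    f₂ : ∀ p q → p * (q * 1) ≡ p * q
    f₂ = solve-∀
    f₃ : ∀ p r → p * (r * 1) ≡ r * p
    f₃ = solve-∀
    f₈ : ∀ p q r → p * (q * (r * 1)) ≡ r * (p * q)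
    f₈ = solve-∀

  a-ternary : ∀ {m n m′ n′} → p * m + q * n ≡ 1 + p * q → m + m′ ≡ q → n + n′ ≡ p →
    ∀ k → a (p * q * r) k ≡ ternary p q r m n m′ n′ k
  a-ternary {m} {n} {m′} {n′} bez hm hn k = trans (a≡ (ℕ.*-mono-≤ (ℕ.*-mono-≤ 1≤p (prime>1 pq)) 1≤r))
    (≐-trans cycSeries-factors (≐-sym (ternary-unique p q r m n m′ n′ 1≤p 1≤q 1≤r bez hm hn)) .at k)
    where
    a≡ : ∀ {N} → 2 ≤ N → a N k ≡ cycSeries N k
    a≡ (s≤s (s≤s _)) = refl

-- Coefficients of Φ_pqr

euclidℤ : ∀ {q} → Prime q → ∀ w {z} → ¬ q ∣ w → + q ∣ℤ + w ℤ.* z → + q ∣ℤ z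
euclidℤ {q} pq w {z} q∤w d with euclidsLemma w ℤ.∣ z ∣ pq (subst (q ∣_) (ℤ.abs-* (+ w) z) (ℤ∣.∣⇒∣ᵤ d))
... | inj₁ q∣w = contradiction q∣w q∤w
... | inj₂ q∣z = ℤ∣.∣ᵤ⇒∣ q∣z

∣-∸⇒≡ : ∀ {n x y} → y ≤ x → x < n → n ∣ x ∸ y → x ≡ y
∣-∸⇒≡ {n} {x} {y} y≤x x<n d with x ∸ y in eq
... | zero  = ℕ.≤-antisym (ℕ.m∸n≡0⇒m≤n eq) y≤x
... | suc z = contradiction d (>⇒∤ (ℕ.≤-<-trans (ℕ.≤-trans (ℕ.≤-reflexive (sym eq)) (ℕ.m∸n≤m x y)) x<n))

residue-unique : ∀ {n x y} → x < n → y < n → + n ∣ℤ + x ℤ.- + y → x ≡ y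
residue-unique {n} {x} {y} x<n y<n d with ℕ.≤-total y x
... | inj₁ y≤x = ∣-∸⇒≡ y≤x x<n (subst (n ∣_) (cong ℤ.∣_∣ (trans (ℤ.m-n≡m⊖n x y) (ℤ.⊖-≥ y≤x))) (ℤ∣.∣⇒∣ᵤ d))
... | inj₂ x≤y = sym (∣-∸⇒≡ x≤y y<n (subst (n ∣_) (trans (ℤ.∣i-j∣≡∣j-i∣ (+ x) (+ y)) (cong ℤ.∣_∣ (trans (ℤ.m-n≡m⊖n y x) (ℤ.⊖-≥ x≤y)))) (ℤ∣.∣⇒∣ᵤ d)))

sum<-pick : ∀ n (f : ℕ → ℤ) X → (∀ x → x < n → x ≢ X → f x ≡ + 0) →
  sum< n f ≡ (if suc X ≤ᵇ n then f X else + 0)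
sum<-pick zero f X h = refl
sum<-pick (suc n) f zero h = trans (cong (ℤ._+_ (f 0)) (sum<-0 n λ j j<n → h (suc j) (s≤s j<n) λ ()))
  (ℤ.+-identityʳ (f 0))
sum<-pick (suc n) f (suc X) h = trans (cong₂ ℤ._+_ (h 0 (s≤s z≤n) λ ())
    (sum<-pick n (f ∘ suc) X λ x x<n x≢X → h (suc x) (s≤s x<n) (x≢X ∘ ℕ.suc-injective)))
  (ℤ.+-identityˡ _)

sum<-pick₂ : ∀ m n (f : ℕ → ℕ → ℤ) X Y →
  (∀ x y → x < m → y < n → ¬ (x ≡ X × y ≡ Y) → f x y ≡ + 0) →
  sum< m (λ x → sum< n (f x)) ≡ (if suc X ≤ᵇ m then (if suc Y ≤ᵇ n then f X Y else + 0) else + 0)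
sum<-pick₂ m n f X Y h = trans
  (sum<-pick m (λ x → sum< n (f x)) X λ x x<m x≢X → sum<-0 n λ y y<n → h x y x<m y<n (x≢X ∘ proj₁))
  (inner (suc X ≤ᵇ m) refl)
  where
  inner : ∀ b → (suc X ≤ᵇ m) ≡ b →
    (if b then sum< n (f X) else + 0) ≡ (if b then (if suc Y ≤ᵇ n then f X Y else + 0) else + 0)
  inner false _ = refl
  inner true eq = sum<-pick n (f X) Y λ y y<n y≢Y →
    h X y (ℕ.≤ᵇ⇒≤ (suc X) m (subst T (sym eq) _)) y<n (y≢Y ∘ proj₂)

multiples-term-no : ∀ {n} E k → ¬ (+ n ∣ℤ + k ℤ.- + E) → shift E (multiples n) k ≡ + 0
multiples-term-no {n} E k ¬d with ℕ.<-≤-connex k E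
... | inj₁ k<E = shift-< (multiples n) k<E
... | inj₂ E≤k = trans (shift-≥ (multiples n) E≤k) (multiples-no λ d →
  ¬d (subst (+ n ∣ℤ_) (sym (trans (ℤ.m-n≡m⊖n k E) (ℤ.⊖-≥ E≤k))) (ℤ∣.∣ᵤ⇒∣ d)))

-- For j < n the condition j + e ≤ k may be replaced by e ≤ k: the difference k − (j + e) is a multiple of n.
multiples-term-yes : ∀ {n j e k} → j < n → + n ∣ℤ + k ℤ.- + (j + e) →
  shift (j + e) (multiples n) k ≡ indicator (e ≤ᵇ k)
multiples-term-yes {n} {j} {e} {k} j<n d with ℕ.<-≤-connex k e
... | inj₁ k<e rewrite ≤ᵇ-false k<e = shift-< (multiples n) (ℕ.<-≤-trans k<e (ℕ.m≤n+m e j))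
... | inj₂ e≤k rewrite ≤ᵇ-true e≤k with ℕ.<-≤-connex k (j + e)
...   | inj₂ E≤k = trans (shift-≥ (multiples n) E≤k) (multiples-yes
  (subst (n ∣_) (cong ℤ.∣_∣ (trans (ℤ.m-n≡m⊖n k (j + e)) (ℤ.⊖-≥ E≤k))) (ℤ∣.∣⇒∣ᵤ d)))
...   | inj₁ k<E = contradiction gap-∣ (gap-∤ (ℕ.m<n⇒0<n∸m k<E) (ℕ.≤-<-trans gap≤j j<n))
  where
  gap-∣ : n ∣ (j + e) ∸ k
  gap-∣ = subst (n ∣_) (trans (ℤ.∣i-j∣≡∣j-i∣ (+ k) (+ (j + e)))
    (cong ℤ.∣_∣ (trans (ℤ.m-n≡m⊖n (j + e) k) (ℤ.⊖-≥ (ℕ.<⇒≤ k<E))))) (ℤ∣.∣⇒∣ᵤ d)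
  gap≤j : (j + e) ∸ k ≤ j
  gap≤j = ℕ.≤-trans (ℕ.∸-monoʳ-≤ (j + e) e≤k) (ℕ.≤-reflexive (ℕ.m+n∸n≡m j e))
  gap-∤ : ∀ {g} → 0 < g → g < n → ¬ n ∣ g
  gap-∤ {suc g} _ g<n = >⇒∤ g<n

prime-∤ : ∀ {s t} → Prime s → Prime t → s ≢ t → ¬ s ∣ t
prime-∤ ps pt s≢t d with prime⇒irreducible pt d
... | inj₁ refl = ¬prime[1] ps
... | inj₂ s≡t  = s≢t s≡t

∤* : ∀ {s t u} → Prime s → Prime t → Prime u → s ≢ t → s ≢ u → ¬ s ∣ t * u
∤* {s} {t} {u} ps pt pu s≢t s≢u d with euclidsLemma t u ps d
... | inj₁ d′ = prime-∤ ps pt s≢t d′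
... | inj₂ d′ = prime-∤ ps pu s≢u d′

-- The coefficient of x^k in x^j · Φ_pq(x^r)/(1 - x^pq), for any j < pq, where (x, y) is the grid
-- point with j + r(px + qy) ≡ k mod pq. Points with x < m, y ≥ n or x ≥ m, y < n contribute
-- nothing.
binaryTerm : (p q r m n k x y : ℕ) → ℤ
binaryTerm p q r m n k x y =
  if suc x ≤ᵇ m
  then indicator ((suc y ≤ᵇ n) ∧ (r * (p * x + q * y) ≤ᵇ k))
  else ℤ.- indicator ((n ≤ᵇ y) ∧ (r * (p * x + q * y) ≤ᵇ k + r * (p * q)))

module Coefficient {p q r : ℕ} (pp : Prime p) (pq : Prime q) (p<q : p < q) (q<r : q < r) (pr : Prime r)
  {m n m′ n′ : ℕ} (bez : p * m + q * n ≡ 1 + p * q) (hm : m + m′ ≡ q) (hn : n + n′ ≡ p) (k : ℕ) where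

  e : ℕ → ℕ → ℕ
  e x y = r * (p * x + q * y)

  binary-term : ℕ → ℕ → ℤ
  binary-term = binaryTerm p q r m n k

  private
    M : Series
    M = multiples (p * q)

    p∤rq : ¬ p ∣ r * q
    p∤rq = ∤* pp pr pq (ℕ.<⇒≢ (ℕ.<-trans p<q q<r)) (ℕ.<⇒≢ p<q)
    q∤rp : ¬ q ∣ r * p
    q∤rp = ∤* pq pr pp (ℕ.<⇒≢ q<r) (ℕ.<⇒≢ p<q ∘ sym)

    +e : ∀ x y → + e x y ≡ + r ℤ.* (+ p ℤ.* + x ℤ.+ + q ℤ.* + y)
    +e x y = trans (ℤ.pos-* r _) (cong (ℤ._*_ (+ r)) (trans (ℤ.pos-+ (p * x) (q * y))
      (cong₂ ℤ._+_ (ℤ.pos-* p x) (ℤ.pos-* q y))))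

  -- Chinese remaindering: subtracting the congruences leaves rp(x - X) + rq(y - Y), where rp is a
  -- unit modulo q and rq a unit modulo p.
  grid-unique : ∀ j {x y X Y} → x < q → y < p → X < q → Y < p →
    + (p * q) ∣ℤ + k ℤ.- + (j + e x y) → + (p * q) ∣ℤ + k ℤ.- + (j + e X Y) → x ≡ X × y ≡ Y
  grid-unique j {x} {y} {X} {Y} x<q y<p X<q Y<p d D =
    residue-unique x<q X<q (euclidℤ pq (r * p) q∤rp (subst (+ q ∣ℤ_) (sym (cong (ℤ._* (+ x ℤ.- + X)) (ℤ.pos-* r p)))
      (ℤ∣.∣m+n∣n⇒∣m (subst (+ q ∣ℤ_) split (ℤ∣.∣-trans q∣pq diff)) (ℤ∣.∣m⇒∣m*n _ (ℤ∣.∣n⇒∣m*n (+ r) ℤ∣.∣-refl))))) ,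
    residue-unique y<p Y<p (euclidℤ pp (r * q) p∤rq (subst (+ p ∣ℤ_) (sym (cong (ℤ._* (+ y ℤ.- + Y)) (ℤ.pos-* r q)))
      (ℤ∣.∣m+n∣m⇒∣n (subst (+ p ∣ℤ_) split (ℤ∣.∣-trans p∣pq diff)) (ℤ∣.∣m⇒∣m*n _ (ℤ∣.∣n⇒∣m*n (+ r) ℤ∣.∣-refl)))))
    where
    q∣pq : + q ∣ℤ + (p * q)
    q∣pq = ℤ∣.divides (+ p) (ℤ.pos-* p q)
    p∣pq : + p ∣ℤ + (p * q)
    p∣pq = ℤ∣.divides (+ q) (trans (ℤ.pos-* p q) (ℤ.*-comm (+ p) (+ q)))
    diff : + (p * q) ∣ℤ (+ k ℤ.- + (j + e X Y)) ℤ.- (+ k ℤ.- + (j + e x y))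
    diff = ℤ∣.∣m∣n⇒∣m-n D d
    split : (+ k ℤ.- + (j + e X Y)) ℤ.- (+ k ℤ.- + (j + e x y)) ≡
      + r ℤ.* + p ℤ.* (+ x ℤ.- + X) ℤ.+ + r ℤ.* + q ℤ.* (+ y ℤ.- + Y)
    split = trans
      (cong₂ (λ u v → (+ k ℤ.- (+ j ℤ.+ u)) ℤ.- (+ k ℤ.- (+ j ℤ.+ v))) (+e X Y) (+e x y))
      (solve 9 (λ k j r p q x y X Y →
        (k :- (j :+ r :* (p :* X :+ q :* Y))) :- (k :- (j :+ r :* (p :* x :+ q :* y))) :=
        r :* p :* (x :- X) :+ r :* q :* (y :- Y)) refl
        (+ k) (+ j) (+ r) (+ p) (+ q) (+ x) (+ y) (+ X) (+ Y))

  -- The first double sum covers the corner x < m, y < n of the grid, the second one, after adding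
  -- rpq to its exponents, the opposite corner x ≥ m, y ≥ n. Only one grid point satisfies the
  -- congruence modulo pq, so both sums together have at most one nonzero term.
  shift-binary-term : ∀ {j X Y} → j < p * q → X < q → Y < p → + (p * q) ∣ℤ + k ℤ.- + (j + e X Y) →
    shift j (binary r (r * p) (r * q) m n m′ n′ M) k ≡ binary-term X Y
  shift-binary-term {j} {X} {Y} j<pq X<q Y<p D =
    trans (shift-binary j r (r * p) (r * q) m n m′ n′ M k) (trans (cong₂ ℤ._-_ first second) combine)
    where
    e′ : ∀ x y → r * p * x + r * q * y ≡ e x y
    e′ x y = go p q r x y
      where
      go : ∀ p q r x y → r * p * x + r * q * y ≡ r * (p * x + q * y)
      go = solve-∀
    m≤q : m ≤ q
    m≤q = ℕ.≤-trans (ℕ.m≤m+n m m′) (ℕ.≤-reflexive hm)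
    n≤p : n ≤ p
    n≤p = ℕ.≤-trans (ℕ.m≤m+n n n′) (ℕ.≤-reflexive hn)

    first : sum< m (λ x → sum< n (λ y → shift (j + (r * p * x + r * q * y)) M k)) ≡
      (if suc X ≤ᵇ m then (if suc Y ≤ᵇ n then indicator (e X Y ≤ᵇ k) else + 0) else + 0)
    first = trans
      (sum<-cong m λ x _ → sum<-cong n λ y _ → cong (λ z → shift (j + z) M k) (e′ x y))
      (trans (sum<-pick₂ m n (λ x y → shift (j + e x y) M k) X Y λ x y x<m y<n ne →
          multiples-term-no (j + e x y) k λ d →
            ne (grid-unique j (ℕ.<-≤-trans x<m m≤q) (ℕ.<-≤-trans y<n n≤p) X<q Y<p d D))
        (cong (λ z → if suc X ≤ᵇ m then (if suc Y ≤ᵇ n then z else + 0) else + 0)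
          (multiples-term-yes j<pq D)))

    -- The second sum of Φ_pq has exponents ip + jq − pq with i ≥ m, j ≥ n.
    e-offset : ∀ x y → r + (r * p * x + r * q * y) + r * (p * q) ≡ e (m + x) (n + y)
    e-offset x y = trans (go p q r x y) (trans (cong (λ z → r * (z + (p * x + q * y))) (sym bez)) (go′ p q r x y m n))
      where
      go : ∀ p q r x y → r + (r * p * x + r * q * y) + r * (p * q) ≡ r * ((1 + p * q) + (p * x + q * y))
      go = solve-∀
      go′ : ∀ p q r x y m n → r * ((p * m + q * n) + (p * x + q * y)) ≡ r * (p * (m + x) + q * (n + y))
      go′ = solve-∀
    module _ (x y : ℕ) where
      E : ℕ
      E = r + (r * p * x + r * q * y)
      lifted : + k ℤ.- + (j + e (m + x) (n + y)) ≡ (+ k ℤ.- + (j + E)) ℤ.- + r ℤ.* + (p * q)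
      lifted = trans
        (cong (λ u → + k ℤ.- (+ j ℤ.+ u)) (trans (cong +_ (sym (e-offset x y))) (cong (ℤ._+_ (+ E)) (ℤ.pos-* r (p * q)))))
        (solve 5 (λ k j E r t → k :- (j :+ (E :+ r :* t)) := (k :- (j :+ E)) :- r :* t) refl
          (+ k) (+ j) (+ E) (+ r) (+ (p * q)))
      pq∣rpq : + (p * q) ∣ℤ + r ℤ.* + (p * q)
      pq∣rpq = ℤ∣.∣n⇒∣m*n (+ r) ℤ∣.∣-refl
      lift-∣ : + (p * q) ∣ℤ + k ℤ.- + (j + E) → + (p * q) ∣ℤ + k ℤ.- + (j + e (m + x) (n + y))
      lift-∣ d = subst (+ (p * q) ∣ℤ_) (sym lifted) (ℤ∣.∣m∣n⇒∣m-n d pq∣rpq)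
      lower-∣ : + (p * q) ∣ℤ + k ℤ.- + (j + e (m + x) (n + y)) → + (p * q) ∣ℤ + k ℤ.- + (j + E)
      lower-∣ d = subst (+ (p * q) ∣ℤ_) (trans (cong (ℤ._+ + r ℤ.* + (p * q)) lifted)
        (solve 2 (λ a b → (a :- b) :+ b := a) refl (+ k ℤ.- + (j + E)) (+ r ℤ.* + (p * q))))
        (ℤ∣.∣m∣n⇒∣m+n d pq∣rpq)
      below : (E ≤ᵇ k) ≡ (e (m + x) (n + y) ≤ᵇ k + r * (p * q))
      below rewrite sym (e-offset x y) with ℕ.<-≤-connex k E
      ... | inj₁ k<E = trans (≤ᵇ-false k<E) (sym (≤ᵇ-false (ℕ.+-monoˡ-< (r * (p * q)) k<E)))
      ... | inj₂ E≤k = trans (≤ᵇ-true E≤k) (sym (≤ᵇ-true (ℕ.+-monoˡ-≤ (r * (p * q)) E≤k)))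

    secondSum : ℤ
    secondSum = sum< m′ (λ x → sum< n′ (λ y → shift (j + (r + (r * p * x + r * q * y))) M k))

    in-grid : ∀ {x y} → x < m′ → y < n′ → + (p * q) ∣ℤ + k ℤ.- + (j + E x y) → m + x ≡ X × n + y ≡ Y
    in-grid {x} {y} x<m′ y<n′ d = grid-unique j (subst (m + x <_) hm (ℕ.+-monoʳ-< m x<m′))
      (subst (n + y <_) hn (ℕ.+-monoʳ-< n y<n′)) X<q Y<p (lift-∣ x y d) D

    second : secondSum ≡
      (if suc X ≤ᵇ m then + 0 else (if n ≤ᵇ Y then indicator (e X Y ≤ᵇ k + r * (p * q)) else + 0))
    second with ℕ.<-≤-connex X m
    ... | inj₁ X<m rewrite ≤ᵇ-true X<m = sum<-0 m′ λ x x<m′ → sum<-0 n′ λ y y<n′ →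
      multiples-term-no (j + E x y) k λ d → ℕ.<⇒≱ X<m (subst (m ≤_) (proj₁ (in-grid x<m′ y<n′ d)) (ℕ.m≤m+n m x))
    ... | inj₂ m≤X rewrite ≤ᵇ-false (s≤s m≤X) with ℕ.<-≤-connex Y n
    ...   | inj₁ Y<n rewrite ≤ᵇ-false Y<n = sum<-0 m′ λ x x<m′ → sum<-0 n′ λ y y<n′ →
      multiples-term-no (j + E x y) k λ d → ℕ.<⇒≱ Y<n (subst (n ≤_) (proj₂ (in-grid x<m′ y<n′ d)) (ℕ.m≤m+n n y))
    ...   | inj₂ n≤Y rewrite ≤ᵇ-true n≤Y = trans
      (sum<-pick₂ m′ n′ (λ x y → shift (j + E x y) M k) (X ∸ m) (Y ∸ n) λ x y x<m′ y<n′ ne →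
        multiples-term-no (j + E x y) k λ d → let ex , ey = in-grid x<m′ y<n′ d in
          ne (trans (sym (ℕ.m+n∸m≡n m x)) (cong (_∸ m) ex) , trans (sym (ℕ.m+n∸m≡n n y)) (cong (_∸ n) ey)))
      (trans (cong₂ (λ b c → if b then (if c then shift (j + E (X ∸ m) (Y ∸ n)) M k else + 0) else + 0)
          (≤ᵇ-true (ℕ.+-cancelˡ-< m (X ∸ m) m′ (subst₂ _<_ (sym X≡) (sym hm) X<q)))
          (≤ᵇ-true (ℕ.+-cancelˡ-< n (Y ∸ n) n′ (subst₂ _<_ (sym Y≡) (sym hn) Y<p))))
        (trans (multiples-term-yes j<pq (lower-∣ (X ∸ m) (Y ∸ n) (subst (+ (p * q) ∣ℤ_)
            (cong₂ (λ x y → + k ℤ.- + (j + e x y)) (sym X≡) (sym Y≡)) D)))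
          (cong indicator (trans (below (X ∸ m) (Y ∸ n))
            (cong₂ (λ x y → e x y ≤ᵇ k + r * (p * q)) X≡ Y≡)))))
      where
      X≡ : m + (X ∸ m) ≡ X
      X≡ = ℕ.m+[n∸m]≡n m≤X
      Y≡ : n + (Y ∸ n) ≡ Y
      Y≡ = ℕ.m+[n∸m]≡n n≤Y

    combine : (if suc X ≤ᵇ m then (if suc Y ≤ᵇ n then indicator (e X Y ≤ᵇ k) else + 0) else + 0) ℤ.-
      (if suc X ≤ᵇ m then + 0 else (if n ≤ᵇ Y then indicator (e X Y ≤ᵇ k + r * (p * q)) else + 0))
      ≡ binary-term X Y
    combine with suc X ≤ᵇ m | suc Y ≤ᵇ n | n ≤ᵇ Y
    ... | true  | true  | _     = ℤ.+-identityʳ _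
    ... | true  | false | _     = refl
    ... | false | _     | true  = ℤ.+-identityˡ _
    ... | false | _     | false = refl

-- Maximising sums along rotation orbits

ind : Bool → ℕ
ind true = 1
ind false = 0

-- Written with `_<ᵇ_`, which is built in for literals, because these functions run inside the
-- evaluation of `checkAll`.
max min : ℕ → ℕ → ℕ
max x y = if x <ᵇ y then y else x
min x y = if x <ᵇ y then x else y

maxUpTo : ℕ → (ℕ → ℕ) → ℕ
maxUpTo zero f = f 0
maxUpTo (suc k) f = max (f (suc k)) (maxUpTo k f)

nth : {X : Set} → X → List X → ℕ → X
nth d [] _ = d
nth d (x ∷ xs) zero = x
nth d (x ∷ xs) (suc i) = nth d xs i

every : {X : Set} → (X → Bool) → List X → Bool
every f [] = true
every f (x ∷ xs) = if f x then every f xs else false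

Layer : Set
Layer = List ℕ × List ℕ

zipMin : List ℕ → List ℕ → List ℕ → List ℕ → List ℕ
zipMin (t ∷ ts) (x ∷ xs) (y ∷ ys) (z ∷ zs) = (t + min x (min y z)) ∷ zipMin ts xs ys zs
zipMin _ _ _ _ = []

-- v₀ and v₁ list, for ε = 0 and ε = 1, the least total deficit of a path ending at (α, ε); the entry α of
-- drop τ (v ++ v) is the entry α + τ mod p of v.
advance : ℕ → Layer → Layer → Layer
advance τ (t₀ , t₁) (v₀ , v₁) =
  zipMin t₀ (drop τ (v₀ ++ v₀)) (drop τ (v₁ ++ v₁)) (drop (suc τ) (v₀ ++ v₀)) ,
  zipMin t₁ (drop τ (v₁ ++ v₁)) (drop (suc τ) (v₀ ++ v₀)) (drop (suc τ) (v₁ ++ v₁))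

dead : ℕ → Layer → Bool
dead σ (v₀ , v₁) = if every (σ <ᵇ_) v₀ then every (σ <ᵇ_) v₁ else false

module _ (p : ℕ) .{{_ : NonZero p}} (d : ℕ) where
  safe : ℕ → ℕ → List Layer → ℕ → ℕ → Layer → Bool
  safe σ τ rows zero    y V = dead σ V
  safe σ τ rows (suc i) y V = if dead σ V then true else
    -- The residue y moves by -d, independently of (α, ε); the abstraction over y′ shares its
    -- evaluation.
    (λ y′ → safe σ τ rows i y′ (advance τ (nth ([] , []) rows y′) V)) ((y + (p ∸ d)) % p)

  safeAll : ℕ → List Layer → Bool
  safeAll σ rows = every (λ y → every (λ τ → safe σ τ rows (pred p) y (nth ([] , []) rows y)) (upTo p)) (upTo p)

  layer : ℕ → (ℕ → ℕ → ℕ) → Layer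
  layer t w = map (λ α → t ∸ w 0 α) (upTo p) , map (λ α → t ∸ w 1 α) (upTo p)

  -- Is every sum of f along a walk at most M?  The deficits top − f of a walk have to add up to Σ top − M or more.
  check : ℕ → (ℕ → ℕ) → (ℕ → ℕ → ℕ → ℕ) → Bool
  check M top w = (λ S → if S ≤ᵇ M then true else
    safeAll (S ∸ suc M) (map (λ y → layer (top y) (w y)) (upTo p))) (sum (map top (upTo p)))

module _ (p n K : ℕ) where
  -- With s = α + ε:  h = h⁺ if α < p − n and h = − h⁻ otherwise.
  h⁺ h⁻ : ℕ → ℕ → ℕ
  h⁺ s y = if y <ᵇ n then ind (y + s ≤ᵇ K) else 0
  h⁻ s y = if y <ᵇ n then 0 else ind (y + s ≤ᵇ K + p)

  -- 1 + h(u) − h(v)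
  weight : ℕ → ℕ → ℕ → ℕ → ℕ
  weight u v ε α = if α + n <ᵇ p then suc (h⁺ (α + ε) u) ∸ h⁺ (α + ε) v
                                 else suc (h⁻ (α + ε) v) ∸ h⁻ (α + ε) u

  -- The sum s = α + ε ranges over 0, ..., p - n as long as α < p - n, and over p - n, ..., p
  -- otherwise; the value p - n occurs in both ranges, with different signs of h.
  top : ℕ → ℕ → ℕ
  top u v = max (maxUpTo (p ∸ n) (λ s → suc (h⁺ s u) ∸ h⁺ s v))
                (maxUpTo n (λ s → suc (h⁻ (p ∸ n + s) v) ∸ h⁻ (p ∸ n + s) u))

-- The second check bounds the negated coefficient.
checkAll : (p n b M : ℕ) .{{_ : NonZero p}} → Bool
checkAll p n b M = every (λ K →
  -- The bound is `M + p` because each of the p weights exceeds its summand by 1; the residue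
  -- `(y + (p ∸ b)) % p` is y - b.
  if check p ((n * b) % p) (M + p) (λ y → top p n K y ((y + (p ∸ b)) % p)) (λ y → weight p n K y ((y + (p ∸ b)) % p))
  then check p ((n * b) % p) (M + p) (λ y → top p n K ((y + (p ∸ b)) % p) y) (λ y → weight p n K ((y + (p ∸ b)) % p) y)
  else false) (upTo p)

-- Soundness of the search over walks

if-true : ∀ {b c} → (if b then c else false) ≡ true → b ≡ true × c ≡ true
if-true {true} eq = refl , eq

min-≤ˡ : ∀ x y → min x y ≤ x
min-≤ˡ x y with x <ᵇ y in eq
... | true  = ℕ.≤-refl
... | false = ℕ.≮⇒≥ λ x<y → subst T eq (ℕ.<⇒<ᵇ x<y)

min-≤ʳ : ∀ x y → min x y ≤ y
min-≤ʳ x y with x <ᵇ y in eq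
... | true  = ℕ.<⇒≤ (ℕ.<ᵇ⇒< x y (subst T (sym eq) tt))
... | false = ℕ.≤-refl

max-≥ˡ : ∀ x y → x ≤ max x y
max-≥ˡ x y with x <ᵇ y in eq
... | true  = ℕ.<⇒≤ (ℕ.<ᵇ⇒< x y (subst T (sym eq) tt))
... | false = ℕ.≤-refl

max-≥ʳ : ∀ x y → y ≤ max x y
max-≥ʳ x y with x <ᵇ y in eq
... | true  = ℕ.≤-refl
... | false = ℕ.≮⇒≥ λ x<y → subst T eq (ℕ.<⇒<ᵇ x<y)

-- A relation rather than `nth`: a derivation certifies that the index is in range, which a lookup
-- with a default value does not.
data At {X : Set} : List X → ℕ → X → Set where
  here  : ∀ {x xs} → At (x ∷ xs) 0 x
  there : ∀ {x y xs i} → At xs i x → At (y ∷ xs) (suc i) x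

At-every : ∀ {X : Set} {f : X → Bool} {xs i x} → every f xs ≡ true → At xs i x → f x ≡ true
At-every eq here       = proj₁ (if-true eq)
At-every eq (there at) = At-every (proj₂ (if-true eq)) at

At-applyUpTo : ∀ {X : Set} (f : ℕ → X) {n i} → i < n → At (applyUpTo f n) i (f i)
At-applyUpTo f {suc n} {zero}  _         = here
At-applyUpTo f {suc n} {suc i} (s≤s i<n) = there (At-applyUpTo (f ∘ suc) i<n)

At-map-upTo : ∀ {X : Set} (f : ℕ → X) {n i} → i < n → At (map f (upTo n)) i (f i)
At-map-upTo f {n} {i} i<n = subst (λ xs → At xs i (f i)) (sym (List.map-applyUpTo id f n)) (At-applyUpTo f i<n)

length-map-upTo : ∀ {X : Set} (f : ℕ → X) n → length (map f (upTo n)) ≡ n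
length-map-upTo f n = trans (List.length-map f (upTo n)) (List.length-applyUpTo id n)

every-upTo : ∀ {f : ℕ → Bool} {n i} → every f (upTo n) ≡ true → i < n → f i ≡ true
every-upTo eq i<n = At-every eq (At-applyUpTo id i<n)

At-exists : ∀ {X : Set} (xs : List X) {i} → i < length xs → ∃ λ x → At xs i x
At-exists (x ∷ xs) {zero}  _       = x , here
At-exists (x ∷ xs) {suc i} (s≤s h) = let y , at = At-exists xs h in y , there at

At-++ˡ : ∀ {X : Set} {xs ys : List X} {i x} → At xs i x → At (xs ++ ys) i x
At-++ˡ here       = here
At-++ˡ (there at) = there (At-++ˡ at)

At-++ʳ : ∀ {X : Set} (xs : List X) {ys i x} → At ys i x → At (xs ++ ys) (length xs + i) x
At-++ʳ []       at = at
At-++ʳ (x ∷ xs) at = there (At-++ʳ xs at)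

At-drop : ∀ {X : Set} k {xs : List X} {i x} → At xs (k + i) x → At (drop k xs) i x
At-drop zero    at         = at
At-drop (suc k) (there at) = At-drop k at

nth-At : ∀ {X : Set} {z : X} {xs i x} → At xs i x → nth z xs i ≡ x
nth-At here       = refl
nth-At (there at) = nth-At at

At-zipMin : ∀ {ts xs ys zs i t x y z} → At ts i t → At xs i x → At ys i y → At zs i z →
  At (zipMin ts xs ys zs) i (t + min x (min y z))
At-zipMin here       here       here       here       = here
At-zipMin (there at) (there bt) (there ct) (there dt) = there (At-zipMin at bt ct dt)

length-zipMin : ∀ ts xs ys zs → length ts ≤ length xs → length ts ≤ length ys → length ts ≤ length zs →
  length (zipMin ts xs ys zs) ≡ length ts
length-zipMin [] _ _ _ _ _ _ = refl
length-zipMin (t ∷ ts) (x ∷ xs) (y ∷ ys) (z ∷ zs) (s≤s h) (s≤s h′) (s≤s h″) =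
  cong suc (length-zipMin ts xs ys zs h h′ h″)

total : ℕ → (ℕ → ℕ) → ℕ
total zero    f = 0
total (suc n) f = f 0 + total n (f ∘ suc)

sum-upTo : ∀ n (f : ℕ → ℕ) → sum (map f (upTo n)) ≡ total n f
sum-upTo n f = trans (cong sum (List.map-applyUpTo id f n)) (go n f)
  where
  go : ∀ n (f : ℕ → ℕ) → sum (applyUpTo f n) ≡ total n f
  go zero    f = refl
  go (suc n) f = cong (_+_ (f 0)) (go n (f ∘ suc))

total-cong : ∀ n {f g : ℕ → ℕ} → (∀ i → f i ≡ g i) → total n f ≡ total n g
total-cong zero    h = refl
total-cong (suc n) h = cong₂ _+_ (h 0) (total-cong n (h ∘ suc))

total-+ : ∀ n (f g : ℕ → ℕ) → total n (λ i → f i + g i) ≡ total n f + total n g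
total-+ zero    f g = refl
total-+ (suc n) f g rewrite total-+ n (f ∘ suc) (g ∘ suc) =
  interchange (f 0) (g 0) (total n (f ∘ suc)) (total n (g ∘ suc))

total-mono : ∀ n {f g : ℕ → ℕ} → (∀ i → f i ≤ g i) → total n f ≤ total n g
total-mono zero    h = z≤n
total-mono (suc n) h = ℕ.+-mono-≤ (h 0) (total-mono n (h ∘ suc))

side : Layer → ℕ → List ℕ
side V zero    = proj₁ V
side V (suc _) = proj₂ V

-- A step x ↦ x − c of a rotation of ℤ/q, seen through α = ⌊px/q⌋ and ε = [px mod q > ν]:
-- subtracting the fractional part of pc/q either does not borrow, and then px mod q decreases,
-- or does borrow, and then px mod q increases.
data Step (p τ α ε α′ ε′ : ℕ) : Set where
  plain  : α′ + τ     ≡ α ⊎ α′ + τ     ≡ α + p → ε′ ≤ ε → Step p τ α ε α′ ε′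
  borrow : α′ + suc τ ≡ α ⊎ α′ + suc τ ≡ α + p → ε ≤ ε′ → Step p τ α ε α′ ε′

module _ {p : ℕ} where

  -- `zipMin` stops at the shortest list, and a missing entry could make a layer look dead. Full
  -- length ensures that every state (α, ε) is represented.
  Full : Layer → Set
  Full V = length (proj₁ V) ≡ p × length (proj₂ V) ≡ p

  At-rotate : ∀ {v : List ℕ} {t α α′ x} → length v ≡ p → At v α x →
    α′ + t ≡ α ⊎ α′ + t ≡ α + p → At (drop t (v ++ v)) α′ x
  At-rotate {v} {t} {α} {α′} {x} len at (inj₁ eq) =
    At-drop t (subst (λ i → At (v ++ v) i x) (trans (sym eq) (ℕ.+-comm α′ t)) (At-++ˡ at))
  At-rotate {v} {t} {α} {α′} {x} len at (inj₂ eq) =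
    At-drop t (subst (λ i → At (v ++ v) i x)
      (trans (cong (λ z → z + α) len) (trans (ℕ.+-comm p α) (trans (sym eq) (ℕ.+-comm α′ t)))) (At-++ʳ v at))

  length-rotate : ∀ {v : List ℕ} {t} → length v ≡ p → t ≤ p → p ≤ length (drop t (v ++ v))
  length-rotate {v} {t} len t≤p = ℕ.≤-trans (ℕ.≤-trans (ℕ.≤-reflexive (sym (ℕ.m+n∸n≡m p p))) (ℕ.∸-monoʳ-≤ (p + p) t≤p))
    (ℕ.≤-reflexive (sym (trans (List.length-drop t (v ++ v))
      (cong (_∸ t) (trans (List.length-++ v) (cong₂ _+_ len len))))))

  rotate-exists : ∀ (v : List ℕ) {t α} → length v ≡ p → t ≤ p → α < p → ∃ λ x → At (drop t (v ++ v)) α x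
  rotate-exists v {t} len t≤p α<p = At-exists (drop t (v ++ v)) (ℕ.<-≤-trans α<p (length-rotate {v} len t≤p))

  advance-full : ∀ {τ D V} → τ < p → Full D → Full V → Full (advance τ D V)
  advance-full {τ} {d₀ , d₁} {v₀ , v₁} τ<p (l₀ , l₁) (k₀ , k₁) =
    trans (length-zipMin d₀ _ _ _ (fit d₀ v₀ l₀ k₀ (ℕ.<⇒≤ τ<p)) (fit d₀ v₁ l₀ k₁ (ℕ.<⇒≤ τ<p)) (fit d₀ v₀ l₀ k₀ τ<p)) l₀ ,
    trans (length-zipMin d₁ _ _ _ (fit d₁ v₁ l₁ k₁ (ℕ.<⇒≤ τ<p)) (fit d₁ v₀ l₁ k₀ τ<p) (fit d₁ v₁ l₁ k₁ τ<p)) l₁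
    where
    fit : ∀ d v {t} → length d ≡ p → length v ≡ p → t ≤ p → length d ≤ length (drop t (v ++ v))
    fit d v l k t≤p = ℕ.≤-trans (ℕ.≤-reflexive l) (length-rotate {v} k t≤p)

  min₁ : ∀ x y z → min x (min y z) ≤ x
  min₁ x y z = min-≤ˡ x (min y z)
  min₂ : ∀ x y z → min x (min y z) ≤ y
  min₂ x y z = ℕ.≤-trans (min-≤ʳ x (min y z)) (min-≤ˡ y z)
  min₃ : ∀ x y z → min x (min y z) ≤ z
  min₃ x y z = ℕ.≤-trans (min-≤ʳ x (min y z)) (min-≤ʳ y z)

  -- For each ε′, monotonicity of ε admits three of the four combinations of old ε and kind of step.
  -- They are the three lists over which `advance` minimises, and the six clauses match them one by
  -- one.
  advance-≤ : ∀ {τ D V α ε α′ ε′ t v} → τ < p → Full V → α′ < p → ε ≤ 1 → ε′ ≤ 1 →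
    Step p τ α ε α′ ε′ → At (side D ε′) α′ t → At (side V ε) α v →
    ∃ λ v′ → At (side (advance τ D V) ε′) α′ v′ × v′ ≤ t + v
  advance-≤ {τ} {V = v₀ , v₁} {t = t} {v} τ<p (k₀ , k₁) α′<p z≤n z≤n (plain eq _) atD atV =
    let y , at₂ = rotate-exists v₁ k₁ (ℕ.<⇒≤ τ<p) α′<p ; z , at₃ = rotate-exists v₀ k₀ τ<p α′<p in
    _ , At-zipMin atD (At-rotate k₀ atV eq) at₂ at₃ , ℕ.+-monoʳ-≤ t (min₁ v y z)
  advance-≤ {τ} {V = v₀ , v₁} {t = t} {v} τ<p (k₀ , k₁) α′<p (s≤s z≤n) z≤n (plain eq _) atD atV =
    let x , at₁ = rotate-exists v₀ k₀ (ℕ.<⇒≤ τ<p) α′<p ; z , at₃ = rotate-exists v₀ k₀ τ<p α′<p in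
    _ , At-zipMin atD at₁ (At-rotate k₁ atV eq) at₃ , ℕ.+-monoʳ-≤ t (min₂ x v z)
  advance-≤ {τ} {V = v₀ , v₁} {t = t} {v} τ<p (k₀ , k₁) α′<p z≤n z≤n (borrow eq _) atD atV =
    let x , at₁ = rotate-exists v₀ k₀ (ℕ.<⇒≤ τ<p) α′<p ; y , at₂ = rotate-exists v₁ k₁ (ℕ.<⇒≤ τ<p) α′<p in
    _ , At-zipMin atD at₁ at₂ (At-rotate k₀ atV eq) , ℕ.+-monoʳ-≤ t (min₃ x y v)
  advance-≤ {τ} {V = v₀ , v₁} {t = t} {v} τ<p (k₀ , k₁) α′<p (s≤s z≤n) (s≤s z≤n) (plain eq _) atD atV =
    let y , at₂ = rotate-exists v₀ k₀ τ<p α′<p ; z , at₃ = rotate-exists v₁ k₁ τ<p α′<p in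
    _ , At-zipMin atD (At-rotate k₁ atV eq) at₂ at₃ , ℕ.+-monoʳ-≤ t (min₁ v y z)
  advance-≤ {τ} {V = v₀ , v₁} {t = t} {v} τ<p (k₀ , k₁) α′<p z≤n (s≤s z≤n) (borrow eq _) atD atV =
    let x , at₁ = rotate-exists v₁ k₁ (ℕ.<⇒≤ τ<p) α′<p ; z , at₃ = rotate-exists v₁ k₁ τ<p α′<p in
    _ , At-zipMin atD at₁ (At-rotate k₀ atV eq) at₃ , ℕ.+-monoʳ-≤ t (min₂ x v z)
  advance-≤ {τ} {V = v₀ , v₁} {t = t} {v} τ<p (k₀ , k₁) α′<p (s≤s z≤n) (s≤s z≤n) (borrow eq _) atD atV =
    let x , at₁ = rotate-exists v₁ k₁ (ℕ.<⇒≤ τ<p) α′<p ; y , at₂ = rotate-exists v₀ k₀ τ<p α′<p in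
    _ , At-zipMin atD at₁ at₂ (At-rotate k₁ atV eq) , ℕ.+-monoʳ-≤ t (min₃ x y v)

dead-< : ∀ {σ V α ε v} → dead σ V ≡ true → At (side V ε) α v → σ < v
dead-< {σ} {ε = zero} {v} eq at =
  ℕ.<ᵇ⇒< σ v (subst T (sym (At-every (proj₁ (if-true eq)) at)) tt)
dead-< {σ} {ε = suc _} {v} eq at =
  ℕ.<ᵇ⇒< σ v (subst T (sym (At-every (proj₂ (if-true eq)) at)) tt)

-- All that is kept of the orbit: y moves deterministically, (α, ε) only within the choices of
-- `Step`. The sequences are infinite so that a tail is composition with `suc`; sums are taken over
-- the first p terms.
record Walk (p d τ : ℕ) .{{_ : NonZero p}} (y α ε : ℕ → ℕ) : Set where
  field
    y<p  : ∀ i → y i < p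
    α<p  : ∀ i → α i < p
    ε≤1  : ∀ i → ε i ≤ 1
    next : ∀ i → y (suc i) ≡ (y i + (p ∸ d)) % p
    step : ∀ i → Step p τ (α i) (ε i) (α (suc i)) (ε (suc i))

walk-tail : ∀ {p d τ} .{{_ : NonZero p}} {y α ε} → Walk p d τ y α ε → Walk p d τ (y ∘ suc) (α ∘ suc) (ε ∘ suc)
walk-tail w = record
  { y<p = Walk.y<p w ∘ suc ; α<p = Walk.α<p w ∘ suc ; ε≤1 = Walk.ε≤1 w ∘ suc
  ; next = Walk.next w ∘ suc ; step = Walk.step w ∘ suc }

module _ {p d τ : ℕ} .{{_ : NonZero p}} (τ<p : τ < p) (δ : ℕ → ℕ → ℕ → ℕ) where

  private
    layers : List Layer
    layers = map (λ y → map (δ y 0) (upTo p) , map (δ y 1) (upTo p)) (upTo p)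

    -- The default layer `([] , [])` would count as dead, so a lookup is meaningful only together
    -- with y < p.
    layerAt : ∀ {y} → y < p → nth ([] , []) layers y ≡ (map (δ y 0) (upTo p) , map (δ y 1) (upTo p))
    layerAt y<p = nth-At (At-map-upTo (λ y → map (δ y 0) (upTo p) , map (δ y 1) (upTo p)) y<p)

    layer-full : ∀ {y} → y < p → Full {p} (nth ([] , []) layers y)
    layer-full {y} y<p rewrite layerAt y<p = length-map-upTo (δ y 0) p , length-map-upTo (δ y 1) p

    layer-At : ∀ {y α ε} → y < p → α < p → ε ≤ 1 → At (side (nth ([] , []) layers y) ε) α (δ y ε α)
    layer-At {y} y<p α<p z≤n       rewrite layerAt y<p = At-map-upTo (δ y 0) α<p
    layer-At {y} y<p α<p (s≤s z≤n) rewrite layerAt y<p = At-map-upTo (δ y 1) α<p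

  -- Invariant: the entry of the layer at the current state of the walk is at most the deficit `acc`
  -- accumulated so far, being a minimum over paths to that state. Once a layer is dead, the
  -- remaining deficits can only increase the total.
  safe-sound : ∀ {σ} i {V y α ε v acc} → Walk p d τ y α ε → Full {p} V →
    At (side V (ε 0)) (α 0) v → v ≤ acc → safe p d σ τ layers i (y 0) V ≡ true →
    σ < acc + total i (λ j → δ (y (suc j)) (ε (suc j)) (α (suc j)))
  safe-sound {σ} zero {V} {ε = ε} {acc = acc} w full at v≤acc ok =
    ℕ.<-≤-trans (dead-< {V = V} {ε = ε 0} ok at) (ℕ.≤-trans v≤acc (ℕ.m≤m+n acc 0))
  safe-sound {σ} (suc i) {V} {y} {α} {ε} {v} {acc} w full at v≤acc ok with dead σ V in isDead
  ... | true  = ℕ.<-≤-trans (dead-< {V = V} {ε = ε 0} isDead at) (ℕ.≤-trans v≤acc (ℕ.m≤m+n acc _))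
  ... | false rewrite sym (Walk.next w 0) =
    let y₁<p = Walk.y<p w 1
        t = δ (y 1) (ε 1) (α 1)
        v′ , at′ , v′≤ = advance-≤ {D = nth ([] , []) layers (y 1)} {V} τ<p full (Walk.α<p w 1)
          (Walk.ε≤1 w 0) (Walk.ε≤1 w 1) (Walk.step w 0)
          (layer-At y₁<p (Walk.α<p w 1) (Walk.ε≤1 w 1)) at
        rest = total i (λ j → δ (y (suc (suc j))) (ε (suc (suc j))) (α (suc (suc j))))
    in subst (σ <_) (trans (cong (λ z → z + rest) (ℕ.+-comm t acc)) (ℕ.+-assoc acc t rest))
         (safe-sound i {acc = t + acc} (walk-tail w)
         (advance-full {D = nth ([] , []) layers (y 1)} {V} τ<p (layer-full y₁<p) full)
         at′ (ℕ.≤-trans v′≤ (ℕ.+-monoʳ-≤ t v≤acc)) ok)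

  safeAll-sound : ∀ {σ} → safeAll p d σ layers ≡ true → ∀ {y α ε} → Walk p d τ y α ε →
    σ < total p (λ j → δ (y j) (ε j) (α j))
  safeAll-sound {σ} ok {y} {α} {ε} w = subst (λ z → σ < total z (λ j → δ (y j) (ε j) (α j)))
    (ℕ.suc-pred p)
    -- The starting layer accounts for the first of the p terms, the `pred p` steps for the others.
    (safe-sound (pred p) w (layer-full y₀<p) (layer-At y₀<p (Walk.α<p w 0) (Walk.ε≤1 w 0)) ℕ.≤-refl
      (every-upTo (every-upTo ok y₀<p) τ<p))
    where
    y₀<p : y 0 < p
    y₀<p = Walk.y<p w 0

-- The premise on the totals will hold because y permutes the residues modulo p. It makes Σ top - Σ
-- f the total deficit of the walk, so that large sums are small deficits.
check-sound : ∀ {p d M} .{{_ : NonZero p}} {top : ℕ → ℕ} {f : ℕ → ℕ → ℕ → ℕ} → check p d M top f ≡ true →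
  (∀ {y ε α} → y < p → ε ≤ 1 → α < p → f y ε α ≤ top y) →
  ∀ {τ y α ε} → τ < p → Walk p d τ y α ε → total p (top ∘ y) ≡ total p top →
  total p (λ i → f (y i) (ε i) (α i)) ≤ M
check-sound {p} {d} {M} {top} {f} ok f≤top {τ} {y} {α} {ε} τ<p w eq
  with sum (map top (upTo p)) ≤ᵇ M in enough
... | true  = ℕ.≤-trans (total-mono p λ i → f≤top (Walk.y<p w i) (Walk.ε≤1 w i) (Walk.α<p w i))
  (subst (_≤ M) (trans (sum-upTo p top) (sym eq)) (ℕ.≤ᵇ⇒≤ _ M (subst T (sym enough) tt)))
-- In this case S > M, so the truncated difference `S ∸ suc M` is exactly the largest deficit of a
-- walk whose sum exceeds M.
... | false = ℕ.≮⇒≥ λ M<Σf → ℕ.<⇒≱ (safeAll-sound τ<p δ ok w)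
    (ℕ.≤-trans (ℕ.≤-reflexive (Σδ≡)) (ℕ.∸-monoʳ-≤ S M<Σf))
  where
  S : ℕ
  S = sum (map top (upTo p))
  δ : ℕ → ℕ → ℕ → ℕ
  δ y ε α = top y ∸ f y ε α
  Σf Σδ : ℕ
  Σf = total p (λ i → f (y i) (ε i) (α i))
  Σδ = total p (λ i → δ (y i) (ε i) (α i))
  balance : Σf + Σδ ≡ S
  balance = trans (sym (total-+ p (λ i → f (y i) (ε i) (α i)) (λ i → δ (y i) (ε i) (α i))))
    (trans (total-cong p λ i → ℕ.m+[n∸m]≡n (f≤top (Walk.y<p w i) (Walk.ε≤1 w i) (Walk.α<p w i)))
      (trans eq (sym (sum-upTo p top))))
  Σδ≡ : Σδ ≡ S ∸ Σf
  Σδ≡ = sym (trans (cong (_∸ Σf) (sym balance)) (ℕ.m+n∸m≡n Σf Σδ))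

-- Congruences and the grid point of each summand

∣ℤ-combine : ∀ {d x y w : ℤ} → w ≡ x ℤ.+ y → d ∣ℤ x → d ∣ℤ y → d ∣ℤ w
∣ℤ-combine refl = ℤ∣.∣m∣n⇒∣m+n

%ℕ-∣ : ∀ z n .{{_ : NonZero n}} → + n ∣ℤ z ℤ.- + (z %ℕ n)
%ℕ-∣ z n = ℤ∣.divides (z /ℕ n) (trans (cong (ℤ._- + (z %ℕ n)) (a≡a%ℕn+[a/ℕn]*n z n))
  (solve 2 (λ x y → (x :+ y) :- x := y) refl (+ (z %ℕ n)) ((z /ℕ n) ℤ.* + n)))

%ℕ-cong : ∀ {n z w} .{{_ : NonZero n}} → + n ∣ℤ z ℤ.- w → z %ℕ n ≡ w %ℕ n
%ℕ-cong {n} {z} {w} d = residue-unique (n%ℕd<d z n) (n%ℕd<d w n)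
  (∣ℤ-combine (solve 4 (λ z w x y → x :- y := (z :- w) :+ ((w :- y) :- (z :- x))) refl z w (+ (z %ℕ n)) (+ (w %ℕ n)))
    d (ℤ∣.∣m∣n⇒∣m-n (%ℕ-∣ w n) (%ℕ-∣ z n)))

primes-∣ℤ : ∀ {p q z} → Prime p → Prime q → p ≢ q → + p ∣ℤ z → + q ∣ℤ z → + (p * q) ∣ℤ z
primes-∣ℤ {p} {q} {z} pp pq p≢q dp dq with ℤ∣.∣⇒∣ᵤ dp
... | divides t eq with euclidsLemma t p pq (subst (q ∣_) eq (ℤ∣.∣⇒∣ᵤ dq))
...   | inj₂ q∣p with prime⇒irreducible pp q∣p
...     | inj₁ refl = contradiction pq ¬prime[1]
...     | inj₂ q≡p  = contradiction (sym q≡p) p≢q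
primes-∣ℤ {p} {q} {z} pp pq p≢q dp dq | divides t eq | inj₁ q∣t =
  ℤ∣.∣ᵤ⇒∣ (subst (p * q ∣_) (trans (ℕ.*-comm p t) (sym eq)) (*-monoʳ-∣ p q∣t))

total-↭ : ∀ n (f : ℕ → ℕ) (σ : ℕ → ℕ) → (∀ {i} → i < n → σ i < n) → (∀ {i j} → i < n → j < n → σ i ≡ σ j → i ≡ j) →
  (∀ {j} → j < n → ∃ λ i → i < n × σ i ≡ j) → total n (f ∘ σ) ≡ total n f
total-↭ n f σ bounded injective surjective = trans (sym (sum-upTo n (f ∘ σ)))
  (trans (cong sum (List.map-∘ (upTo n)))
    (trans (sum-↭ (Perm.map⁺ f permutation)) (sum-upTo n f)))
  where
  to : ∀ {x} → x ∈ map σ (upTo n) → x ∈ upTo n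
  to x∈ with ∈-map⁻ σ x∈
  ... | i , i∈ , refl = ∈-upTo⁺ (bounded (∈-upTo⁻ i∈))
  from : ∀ {x} → x ∈ upTo n → x ∈ map σ (upTo n)
  from x∈ with surjective (∈-upTo⁻ x∈)
  ... | i , i<n , refl = ∈-map⁺ σ (∈-upTo⁺ i<n)
  permutation : map σ (upTo n) ↭ upTo n
  permutation = unique-↭
    (subst Unique (sym (List.map-applyUpTo id σ n))
      (Unique.applyUpTo⁺₁ σ n λ i<j j<n eq → ℕ.<⇒≢ i<j (injective (ℕ.<-trans i<j j<n) j<n eq)))
    (Unique.upTo⁺ n) to from

-- Formed in ℤ because k - j may be negative.
gridX : (q c k j : ℕ) .{{_ : NonZero q}} → ℕ
gridX q c k j = (+ c ℤ.* (+ k ℤ.- + j)) %ℕ q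

gridY : (p n b k j : ℕ) .{{_ : NonZero p}} → ℕ
gridY p n b k j = (+ n ℤ.* + b ℤ.* (+ k ℤ.- + j)) %ℕ p

coefficient : (p q r m n b c k : ℕ) .{{_ : NonZero p}} .{{_ : NonZero q}} → ℤ
coefficient p q r m n b c k = sum< p λ i →
  binaryTerm p q r m n k (gridX q c k i) (gridY p n b k i) ℤ.-
  binaryTerm p q r m n k (gridX q c k i) (gridY p n b k (i + q))

module Grid {p q r : ℕ} (pp : Prime p) (pq : Prime q) (pr : Prime r) (p<q : p < q) (q<r : q < r)
  {n b c : ℕ} (qn≡1 : + p ∣ℤ + q ℤ.* + n ℤ.- + 1) (rb≡1 : + p ∣ℤ + r ℤ.* + b ℤ.- + 1)
  (rpc≡1 : + q ∣ℤ + r ℤ.* + p ℤ.* + c ℤ.- + 1) (k : ℕ) where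

  private instance
    p≢0 : NonZero p
    p≢0 = prime⇒nonZero pp
    q≢0 : NonZero q
    q≢0 = prime⇒nonZero pq

  xℤ yℤ : ℕ → ℤ
  xℤ j = + c ℤ.* (+ k ℤ.- + j)
  yℤ j = + n ℤ.* + b ℤ.* (+ k ℤ.- + j)

  x y : ℕ → ℕ
  x = λ j → gridX q c k j
  y = λ j → gridY p n b k j

  x<q : ∀ j → x j < q
  x<q j = n%ℕd<d (xℤ j) q

  y<p : ∀ j → y j < p
  y<p j = n%ℕd<d (yℤ j) p

  rqnb≡1 : + p ∣ℤ + r ℤ.* + q ℤ.* (+ n ℤ.* + b) ℤ.- + 1
  rqnb≡1 = ∣ℤ-combine
    (solve 4 (λ q n r b → r :* q :* (n :* b) :- con (+ 1) :=
      (r :* b) :* (q :* n :- con (+ 1)) :+ (r :* b :- con (+ 1))) refl (+ q) (+ n) (+ r) (+ b))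
    (ℤ∣.∣n⇒∣m*n (+ r ℤ.* + b) qn≡1) rb≡1

  -- Modulo p only rqy remains of r(px + qy), and rq · nb ≡ 1 turns y ≡ nb(k - j) into rqy ≡ k - j;
  -- modulo q the same happens with rp · c ≡ 1. The ring identities write this as a combination of
  -- the known congruences.
  on-grid : ∀ j → + (p * q) ∣ℤ + k ℤ.- + (j + r * (p * x j + q * y j))
  on-grid j = subst (+ (p * q) ∣ℤ_) (cong (λ z → + k ℤ.- (+ j ℤ.+ z)) (sym cast))
    (primes-∣ℤ pp pq (ℕ.<⇒≢ p<q)
      (∣ℤ-combine
        (solve 8 (λ k j r p q nb x y → k :- (j :+ r :* (p :* x :+ q :* y)) :=
          (r :* q) :* (nb :* (k :- j) :- y) :+
          (:- (k :- j) :* (r :* q :* nb :- con (+ 1)) :+ p :* (:- (r :* x)))) refl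
          (+ k) (+ j) (+ r) (+ p) (+ q) (+ n ℤ.* + b) (+ x j) (+ y j))
        (ℤ∣.∣n⇒∣m*n (+ r ℤ.* + q) (%ℕ-∣ (yℤ j) p))
        (ℤ∣.∣m∣n⇒∣m+n (ℤ∣.∣n⇒∣m*n (ℤ.- (+ k ℤ.- + j)) rqnb≡1) (ℤ∣.∣m⇒∣m*n _ ℤ∣.∣-refl)))
      (∣ℤ-combine
        (solve 8 (λ k j r p q c x y → k :- (j :+ r :* (p :* x :+ q :* y)) :=
          (r :* p) :* (c :* (k :- j) :- x) :+
          (:- (k :- j) :* (r :* p :* c :- con (+ 1)) :+ q :* (:- (r :* y)))) refl
          (+ k) (+ j) (+ r) (+ p) (+ q) (+ c) (+ x j) (+ y j))
        (ℤ∣.∣n⇒∣m*n (+ r ℤ.* + p) (%ℕ-∣ (xℤ j) q))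
        (ℤ∣.∣m∣n⇒∣m+n (ℤ∣.∣n⇒∣m*n (ℤ.- (+ k ℤ.- + j)) rpc≡1) (ℤ∣.∣m⇒∣m*n _ ℤ∣.∣-refl))))
    where
    cast : + (r * (p * x j + q * y j)) ≡ + r ℤ.* (+ p ℤ.* + x j ℤ.+ + q ℤ.* + y j)
    cast = trans (ℤ.pos-* r _) (cong (ℤ._*_ (+ r)) (cong₂ ℤ._+_ (ℤ.pos-* p (x j)) (ℤ.pos-* q (y j))))

  x-period : ∀ j → x (j + q) ≡ x j
  x-period j = %ℕ-cong {z = xℤ (j + q)} {xℤ j} (ℤ∣.divides (ℤ.- + c)
    (solve 4 (λ c k j q → c :* (k :- (j :+ q)) :- c :* (k :- j) := :- c :* q) refl (+ c) (+ k) (+ j) (+ q)))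

  +∸ : ∀ {i j} → j ≤ i → + (i ∸ j) ≡ + i ℤ.- + j
  +∸ {i} {j} j≤i = sym (trans (ℤ.m-n≡m⊖n i j) (ℤ.⊖-≥ j≤i))

  -- Moving j by q subtracts nbq ≡ b; this is the origin of the argument y - b in the formula.
  y-period : b ≤ p → ∀ j → y (j + q) ≡ (y j + (p ∸ b)) % p
  y-period b≤p j = %ℕ-cong {z = yℤ (j + q)} {+ (y j + (p ∸ b))}
    (∣ℤ-combine (trans (cong (λ z → yℤ (j + q) ℤ.- (+ y j ℤ.+ z)) (+∸ b≤p))
      (solve 7 (λ n b k j q y p → n :* b :* (k :- (j :+ q)) :- (y :+ (p :- b)) :=
        (n :* b :* (k :- j) :- y) :+ (:- b :* (q :* n :- con (+ 1)) :+ p :* :- (con (+ 1)))) refl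
        (+ n) (+ b) (+ k) (+ j) (+ q) (+ y j) (+ p)))
      (%ℕ-∣ (yℤ j) p)
      (ℤ∣.∣m∣n⇒∣m+n (ℤ∣.∣n⇒∣m*n (ℤ.- + b) qn≡1) (ℤ∣.∣m⇒∣m*n _ ℤ∣.∣-refl)))

  d : ℕ
  d = (n * b) % p

  y-step : ∀ j → y (suc j) ≡ (y j + (p ∸ d)) % p
  y-step j = %ℕ-cong {z = yℤ (suc j)} {+ (y j + (p ∸ d))}
    (∣ℤ-combine (trans (cong (λ z → yℤ (suc j) ℤ.- (+ y j ℤ.+ z)) (+∸ (ℕ.<⇒≤ (m%n<n (n * b) p))))
      (solve 6 (λ nb k j y p d → nb :* (k :- (con (+ 1) :+ j)) :- (y :+ (p :- d)) :=
        (nb :* (k :- j) :- y) :+ (:- (nb :- d) :+ p :* :- (con (+ 1)))) refl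
        (+ n ℤ.* + b) (+ k) (+ j) (+ y j) (+ p) (+ d)))
      (%ℕ-∣ (yℤ j) p)
      (ℤ∣.∣m∣n⇒∣m+n (ℤ∣.∣m⇒∣-m (subst (λ z → + p ∣ℤ z ℤ.- + d) (ℤ.pos-* n b) (%ℕ-∣ (+ (n * b)) p)))
        (ℤ∣.∣m⇒∣m*n _ ℤ∣.∣-refl)))

  x-step : c < q → ∀ j → x (suc j) + c ≡ x j ⊎ x (suc j) + c ≡ x j + q
  x-step c<q j with ℕ.<-≤-connex (x (suc j) + c) q
  ... | inj₁ small = inj₁ (residue-unique small (x<q j) dvd)
    where
    dvd : + q ∣ℤ + (x (suc j) + c) ℤ.- + x j
    dvd = ∣ℤ-combine
      (solve 5 (λ c k j x x′ → (x′ :+ c) :- x :=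
        (c :* (k :- j) :- x) :+ :- (c :* (k :- (con (+ 1) :+ j)) :- x′)) refl
        (+ c) (+ k) (+ j) (+ x j) (+ x (suc j)))
      (%ℕ-∣ (xℤ j) q) (ℤ∣.∣m⇒∣-m (%ℕ-∣ (xℤ (suc j)) q))
  ... | inj₂ large = inj₂ (trans (sym (ℕ.m∸n+n≡m large))
    (cong (_+ q) (residue-unique reduced (x<q j) (subst (+ q ∣ℤ_) (cong (ℤ._- + x j) (sym (+∸ large))) dvd))))
    where
    reduced : (x (suc j) + c) ∸ q < q
    reduced = ℕ.+-cancelʳ-< q _ _ (subst (_< q + q) (sym (ℕ.m∸n+n≡m large)) (ℕ.+-mono-< (x<q (suc j)) c<q))
    dvd : + q ∣ℤ (+ (x (suc j) + c) ℤ.- + q) ℤ.- + x j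
    dvd = ∣ℤ-combine
      (solve 6 (λ c k j x x′ q → ((x′ :+ c) :- q) :- x :=
        (c :* (k :- j) :- x) :+ (:- (c :* (k :- (con (+ 1) :+ j)) :- x′) :+ q :* :- (con (+ 1)))) refl
        (+ c) (+ k) (+ j) (+ x j) (+ x (suc j)) (+ q))
      (%ℕ-∣ (xℤ j) q) (ℤ∣.∣m∣n⇒∣m+n (ℤ∣.∣m⇒∣-m (%ℕ-∣ (xℤ (suc j)) q)) (ℤ∣.∣m⇒∣m*n _ ℤ∣.∣-refl))

  y-injective : ∀ {i j} → i < p → j < p → y i ≡ y j → i ≡ j
  y-injective {i} {j} i<p j<p eq = residue-unique i<p j<p
    (∣ℤ-combine
      (solve 6 (λ rq nb k i j y → i :- j :=
        rq :* ((nb :* (k :- j) :- y) :- (nb :* (k :- i) :- y)) :+ :- ((i :- j) :* (rq :* nb :- con (+ 1)))) refl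
        (+ r ℤ.* + q) (+ n ℤ.* + b) (+ k) (+ i) (+ j) (+ y j))
      (ℤ∣.∣n⇒∣m*n (+ r ℤ.* + q) (ℤ∣.∣m∣n⇒∣m-n (%ℕ-∣ (yℤ j) p)
        (subst (λ z → + p ∣ℤ yℤ i ℤ.- + z) eq (%ℕ-∣ (yℤ i) p))))
      (ℤ∣.∣m⇒∣-m (ℤ∣.∣n⇒∣m*n (+ i ℤ.- + j) rqnb≡1)))

  y-surjective : ∀ {w} → w < p → ∃ λ i → i < p × y i ≡ w
  y-surjective {w} w<p = i , n%ℕd<d z p , residue-unique (y<p i) w<p
    (∣ℤ-combine
      (solve 6 (λ rq nb k i w y → y :- w :=
        :- (nb :* (k :- i) :- y) :+ (nb :* ((k :- rq :* w) :- i) :+ w :* (rq :* nb :- con (+ 1)))) refl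
        (+ r ℤ.* + q) (+ n ℤ.* + b) (+ k) (+ i) (+ w) (+ y i))
      (ℤ∣.∣m⇒∣-m (%ℕ-∣ (yℤ i) p))
      (ℤ∣.∣m∣n⇒∣m+n (ℤ∣.∣n⇒∣m*n (+ n ℤ.* + b) (%ℕ-∣ z p)) (ℤ∣.∣n⇒∣m*n (+ w) rqnb≡1)))
    where
    z : ℤ
    -- The solution of nb(k - z) ≡ w, as rq is inverse to nb modulo p.
    z = + k ℤ.- + r ℤ.* + q ℤ.* + w
    i : ℕ
    i = z %ℕ p

  total-y : ∀ f → total p (f ∘ y) ≡ total p f
  total-y f = total-↭ p f y (λ {i} _ → y<p i) y-injective y-surjective

  module _ {m m′ n′ : ℕ} (bez : p * m + q * n ≡ 1 + p * q) (hm : m + m′ ≡ q) (hn : n + n′ ≡ p) where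

    open Coefficient pp pq p<q q<r pr bez hm hn k using (shift-binary-term; binary-term)

    a-formula : a (p * q * r) k ≡ coefficient p q r m n b c k
    a-formula = trans (Ternary.a-ternary pp pq pr p<q q<r bez hm hn k)
      (trans (ternary-coefficient p q r m n m′ n′ k) (sum<-cong p λ i i<p → cong₂ ℤ._-_
        (shift-binary-term (ℕ.<-≤-trans i<p p≤pq) (x<q i) (y<p i) (on-grid i))
        (trans (shift-binary-term (i+q<pq i<p) (x<q (i + q)) (y<p (i + q)) (on-grid (i + q)))
          (cong (λ z → binary-term z (y (i + q))) (x-period i)))))
      where
      p≤pq : p ≤ p * q
      p≤pq = ℕ.m≤m*n p q
      i+q<pq : ∀ {i} → i < p → i + q < p * q
      -- Since i < q and 2 ≤ p, i + q < 2q ≤ pq; the shift by i + q thus stays in the range covered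
      -- by `shift-binary-term`.
      i+q<pq {i} i<p = ℕ.<-≤-trans (ℕ.+-monoˡ-< q (ℕ.<-trans i<p p<q))
        (ℕ.≤-trans (ℕ.≤-reflexive (cong (_+_ q) (sym (ℕ.+-identityʳ q)))) (ℕ.*-monoˡ-≤ q (prime>1 pp)))

-- Bounds for the coefficients of Φ_pqr

≤ᵇ-cong : ∀ {i j k l} → (i ≤ j → k ≤ l) → (k ≤ l → i ≤ j) → (i ≤ᵇ j) ≡ (k ≤ᵇ l)
≤ᵇ-cong {i} {j} f g with ℕ.<-≤-connex j i
... | inj₁ j<i = trans (≤ᵇ-false j<i) (sym (≤ᵇ-false (ℕ.≰⇒> λ k≤l → ℕ.<⇒≱ j<i (g k≤l))))
... | inj₂ i≤j = trans (≤ᵇ-true i≤j) (sym (≤ᵇ-true (f i≤j)))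

<ᵇ-true : ∀ {i j} → i < j → (i <ᵇ j) ≡ true
<ᵇ-true = ≤ᵇ-true

<ᵇ-false : ∀ {i j} → j ≤ i → (i <ᵇ j) ≡ false
<ᵇ-false j≤i = ≤ᵇ-false (s≤s j≤i)

-- Comparison of numbers by quotient and remainder modulo B: the remainders matter only through one
-- bit.
floor-≤ᵇ : ∀ B {s ρ K σ} → ρ < B → σ < B → (ρ + s * B ≤ᵇ σ + K * B) ≡ (s + ind (σ <ᵇ ρ) ≤ᵇ K)
floor-≤ᵇ B {s} {ρ} {K} {σ} ρ<B σ<B with ℕ.<-≤-connex σ ρ
... | inj₂ ρ≤σ rewrite <ᵇ-false ρ≤σ | ℕ.+-identityʳ s = ≤ᵇ-cong {k = s} {K}
  (λ h → ℕ.≮⇒≥ λ K<s → ℕ.<⇒≱ (ℕ.<-≤-trans (ℕ.+-monoˡ-< (K * B) σ<B) (ℕ.≤-trans (ℕ.*-monoˡ-≤ B K<s) (ℕ.m≤n+m (s * B) ρ))) h)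
  (λ s≤K → ℕ.+-mono-≤ ρ≤σ (ℕ.*-monoˡ-≤ B s≤K))
... | inj₁ σ<ρ rewrite <ᵇ-true σ<ρ | ℕ.+-comm s 1 = ≤ᵇ-cong {k = suc s} {K}
  (λ h → ℕ.≰⇒> λ K≤s → ℕ.<⇒≱ (ℕ.+-mono-<-≤ σ<ρ (ℕ.*-monoˡ-≤ B K≤s)) h)
  (λ s<K → ℕ.≤-trans (ℕ.<⇒≤ (ℕ.+-monoˡ-< (s * B) ρ<B)) (ℕ.≤-trans (ℕ.*-monoˡ-≤ B s<K) (ℕ.m≤n+m (K * B) σ)))

divMod-unique : ∀ {n s t ρ σ} .{{_ : NonZero n}} → ρ < n → σ < n → ρ + s * n ≡ σ + t * n → s ≡ t × ρ ≡ σ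
divMod-unique {n} {s} {t} {ρ} {σ} ρ<n σ<n eq =
  ℕ.*-cancelʳ-≡ s t n (ℕ.+-cancelˡ-≡ ρ _ _ (trans eq (cong (_+ t * n) (sym ρ≡σ)))) , ρ≡σ
  where
  ρ≡σ : ρ ≡ σ
  ρ≡σ = trans (sym (m<n⇒m%n≡m ρ<n)) (trans (sym ([m+kn]%n≡m%n ρ s n))
    (trans (cong (_% n) eq) (trans ([m+kn]%n≡m%n σ t n) (m<n⇒m%n≡m σ<n))))

ind≤1 : ∀ b → ind b ≤ 1
ind≤1 true  = ℕ.≤-refl
ind≤1 false = z≤n

ind-<ᵇ-mono : ∀ {ν i j} → i ≤ j → ind (ν <ᵇ i) ≤ ind (ν <ᵇ j)
ind-<ᵇ-mono {ν} {i} {j} i≤j with ℕ.<-≤-connex ν i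
... | inj₁ ν<i rewrite <ᵇ-true ν<i | <ᵇ-true (ℕ.<-≤-trans ν<i i≤j) = ℕ.≤-refl
... | inj₂ i≤ν rewrite <ᵇ-false i≤ν = z≤n

-- Write px = ρ + αq, px′ = ρ′ + α′q and pc = θ + τq. Adding px′ and pc gives px, or px + pq, which
-- merely raises the quotient by p. A carry out of ρ′ + θ is the borrowing step. Without it ρ′ ≤ ρ,
-- with it ρ ≤ ρ′, and for fixed ν the bit ε is monotone in ρ.
rotation-step : ∀ {p q c x x′ ν} .{{_ : NonZero q}} → x′ + c ≡ x ⊎ x′ + c ≡ x + q →
  Step p (p * c / q) (p * x / q) (ind (ν <ᵇ p * x % q)) (p * x′ / q) (ind (ν <ᵇ p * x′ % q))
rotation-step {p} {q} {c} {x} {x′} {ν} h = result (carry h)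
  where
  τ α α′ θ ρ ρ′ : ℕ
  τ  = p * c / q
  α  = p * x / q
  α′ = p * x′ / q
  θ  = p * c % q
  ρ  = p * x % q
  ρ′ = p * x′ % q
  lhs : (ρ′ + θ) + (α′ + τ) * q ≡ p * (x′ + c)
  lhs = trans (go ρ′ θ α′ τ q) (trans (cong₂ _+_ (sym (m≡m%n+[m/n]*n (p * x′) q)) (sym (m≡m%n+[m/n]*n (p * c) q)))
    (sym (ℕ.*-distribˡ-+ p x′ c)))
    where
    go : ∀ a b c d e → (a + b) + (c + d) * e ≡ (a + c * e) + (b + d * e)
    go = solve-∀
  carry : x′ + c ≡ x ⊎ x′ + c ≡ x + q → ∃ λ β → (β ≡ α ⊎ β ≡ α + p) × (ρ′ + θ) + (α′ + τ) * q ≡ ρ + β * q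
  carry (inj₁ eq) = α , inj₁ refl , trans lhs (trans (cong (p *_) eq) (m≡m%n+[m/n]*n (p * x) q))
  carry (inj₂ eq) = α + p , inj₂ refl , trans lhs (trans (cong (p *_) eq) (trans (ℕ.*-distribˡ-+ p x q)
    (trans (cong (_+ p * q) (m≡m%n+[m/n]*n (p * x) q)) (go ρ α p q))))
    where
    go : ∀ a b c d → (a + b * d) + c * d ≡ a + (b + c) * d
    go = solve-∀
  result : (∃ λ β → (β ≡ α ⊎ β ≡ α + p) × (ρ′ + θ) + (α′ + τ) * q ≡ ρ + β * q) →
    Step p τ α (ind (ν <ᵇ ρ)) α′ (ind (ν <ᵇ ρ′))
  result (β , β≡ , eq) with ℕ.<-≤-connex (ρ′ + θ) q
  ... | inj₁ small with divMod-unique {s = α′ + τ} {β} small (m%n<n (p * x) q) eq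
  ...   | refl , ρ≡ = plain β≡ (ind-<ᵇ-mono (subst (ρ′ ≤_) ρ≡ (ℕ.m≤m+n ρ′ θ)))
  result (β , β≡ , eq) | inj₂ large
    with divMod-unique {s = α′ + suc τ} {β} (ℕ.+-cancelʳ-< q _ _ (subst (_< q + q) (sym (ℕ.m∸n+n≡m large))
        (ℕ.+-mono-< (m%n<n (p * x′) q) (m%n<n (p * c) q)))) (m%n<n (p * x) q)
      (trans (trans (go (ρ′ + θ ∸ q) α′ τ q) (cong (_+ (α′ + τ) * q) (ℕ.m∸n+n≡m large))) eq)
    where
    go : ∀ z a b q → z + (a + suc b) * q ≡ (z + q) + (a + b) * q
    go = solve-∀
  ... | refl , ρ≡ = borrow β≡ (ind-<ᵇ-mono (subst (_≤ ρ′) ρ≡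
    (ℕ.+-cancelʳ-≤ q _ _ (subst (_≤ ρ′ + q) (sym (ℕ.m∸n+n≡m large)) (ℕ.+-monoʳ-≤ ρ′ (ℕ.<⇒≤ (m%n<n (p * c) q)))))))

maxUpTo-≥ : ∀ k (f : ℕ → ℕ) {s} → s ≤ k → f s ≤ maxUpTo k f
maxUpTo-≥ zero f z≤n = ℕ.≤-refl
maxUpTo-≥ (suc k) f {s} s≤ with ℕ.m≤n⇒m<n∨m≡n s≤
... | inj₁ (s≤s s≤k) = ℕ.≤-trans (maxUpTo-≥ k f s≤k) (max-≥ʳ (f (suc k)) (maxUpTo k f))
... | inj₂ refl      = max-≥ˡ (f (suc k)) (maxUpTo k f)

-- The function h. The choice between its nonnegative and nonpositive form depends on α alone, hence
-- is common to the two terms of h(x, y) - h(x, y - b).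
value : ℕ → ℕ → ℕ → ℕ → ℕ → ℕ → ℤ
value p n K ε α y = if α + n <ᵇ p then + h⁺ p n K (α + ε) y else ℤ.- + h⁻ p n K (α + ε) y

module _ (p n K : ℕ) where

  h⁺≤1 : ∀ s y → h⁺ p n K s y ≤ 1
  h⁺≤1 s y with y <ᵇ n
  ... | true  = ind≤1 _
  ... | false = z≤n

  h⁻≤1 : ∀ s y → h⁻ p n K s y ≤ 1
  h⁻≤1 s y with y <ᵇ n
  ... | true  = z≤n
  ... | false = ind≤1 _

  suc-∸ : ∀ i j → j ≤ 1 → + (suc i ∸ j) ≡ + 1 ℤ.+ (+ i ℤ.- + j)
  suc-∸ i j j≤1 = trans (sym (trans (ℤ.m-n≡m⊖n (suc i) j) (ℤ.⊖-≥ (ℕ.≤-trans j≤1 (s≤s z≤n)))))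
    (solve 2 (λ i j → (con (+ 1) :+ i) :- j := con (+ 1) :+ (i :- j)) refl (+ i) (+ j))

  weight-value : ∀ u v ε α → + weight p n K u v ε α ≡ + 1 ℤ.+ (value p n K ε α u ℤ.- value p n K ε α v)
  weight-value u v ε α with α + n <ᵇ p
  ... | true  = suc-∸ _ _ (h⁺≤1 (α + ε) v)
  ... | false = trans (suc-∸ _ _ (h⁻≤1 (α + ε) u))
    (solve 2 (λ i j → con (+ 1) :+ (i :- j) := con (+ 1) :+ (:- j :- :- i)) refl
      (+ h⁻ p n K (α + ε) v) (+ h⁻ p n K (α + ε) u))

  weight≤top : n ≤ p → ∀ u v {ε α} → ε ≤ 1 → α < p → weight p n K u v ε α ≤ top p n K u v
  weight≤top n≤p u v {ε} {α} ε≤1 α<p with ℕ.<-≤-connex (α + n) p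
  ... | inj₁ α+n<p rewrite <ᵇ-true α+n<p = ℕ.≤-trans
    (maxUpTo-≥ (p ∸ n) (λ s → suc (h⁺ p n K s u) ∸ h⁺ p n K s v)
      (ℕ.≤-trans (ℕ.+-monoʳ-≤ α ε≤1) (ℕ.≤-trans (ℕ.≤-reflexive (ℕ.+-comm α 1))
        (ℕ.m+n≤o⇒m≤o∸n (suc α) α+n<p))))
    (max-≥ˡ (maxUpTo (p ∸ n) (λ s → suc (h⁺ p n K s u) ∸ h⁺ p n K s v))
      (maxUpTo n (λ s → suc (h⁻ p n K (p ∸ n + s) v) ∸ h⁻ p n K (p ∸ n + s) u)))
  ... | inj₂ p≤α+n rewrite <ᵇ-false p≤α+n = ℕ.≤-trans
    (subst (λ s → suc (h⁻ p n K s v) ∸ h⁻ p n K s u ≤ maxUpTo n f) (ℕ.m+[n∸m]≡n p∸n≤)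
      (maxUpTo-≥ n f (ℕ.≤-trans (ℕ.∸-monoˡ-≤ (p ∸ n) s≤p) (ℕ.≤-reflexive (ℕ.m∸[m∸n]≡n n≤p)))))
    (max-≥ʳ (maxUpTo (p ∸ n) (λ s → suc (h⁺ p n K s u) ∸ h⁺ p n K s v))
      (maxUpTo n f))
    where
    f : ℕ → ℕ
    f s = suc (h⁻ p n K (p ∸ n + s) v) ∸ h⁻ p n K (p ∸ n + s) u
    p∸n≤ : p ∸ n ≤ α + ε
    p∸n≤ = ℕ.≤-trans (ℕ.m≤n+o⇒m∸n≤o p n (subst (p ≤_) (ℕ.+-comm α n) p≤α+n)) (ℕ.m≤m+n α ε)
    s≤p : α + ε ≤ p
    s≤p = ℕ.≤-trans (ℕ.+-monoʳ-≤ α ε≤1) (ℕ.≤-trans (ℕ.≤-reflexive (ℕ.+-comm α 1)) α<p)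

-- The comparisons with K are all true once K ≥ p − 1.
value-cap : ∀ {p n K ε α y} → p ≤ K → ε ≤ 1 → α < p → y < p → value p n K ε α y ≡ value p n (pred p) ε α y
value-cap {p} {n} {K} {ε} {α} {y} p≤K ε≤1 α<p y<p with ℕ.<-≤-connex (α + n) p
... | inj₁ α+n<p rewrite <ᵇ-true α+n<p with ℕ.<-≤-connex y n
...   | inj₂ n≤y rewrite <ᵇ-false n≤y = refl
...   | inj₁ y<n rewrite <ᵇ-true y<n = cong (+_ ∘ ind) (trans (≤ᵇ-true (ℕ.≤-trans le (ℕ.≤-trans ℕ.pred[n]≤n p≤K))) (sym (≤ᵇ-true le)))
  where
  le : y + (α + ε) ≤ pred p
  le = ℕ.<⇒≤pred (begin-strict
    y + (α + ε)  ≤⟨ ℕ.+-monoʳ-≤ y (ℕ.+-monoʳ-≤ α ε≤1) ⟩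
    y + (α + 1)  ≡⟨ go y α ⟩
    α + suc y    ≤⟨ ℕ.+-monoʳ-≤ α y<n ⟩
    α + n        <⟨ α+n<p ⟩
    p ∎)
    where
    open ℕ.≤-Reasoning
    go : ∀ y α → y + (α + 1) ≡ α + suc y
    go = solve-∀
value-cap {p} {n} {K} {ε} {α} {y} p≤K ε≤1 α<p y<p | inj₂ p≤α+n rewrite <ᵇ-false p≤α+n with y <ᵇ n
... | true  = refl
... | false = cong (λ b → ℤ.- + ind b) (trans (≤ᵇ-true (ℕ.≤-trans le (ℕ.+-monoˡ-≤ p (ℕ.≤-trans ℕ.pred[n]≤n p≤K)))) (sym (≤ᵇ-true le)))
  where
  le : y + (α + ε) ≤ pred p + p
  le = ℕ.+-mono-≤ (ℕ.<⇒≤pred y<p) (ℕ.≤-trans (ℕ.+-monoʳ-≤ α ε≤1) (ℕ.≤-trans (ℕ.≤-reflexive (ℕ.+-comm α 1)) α<p))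

total-sum< : ∀ n (w : ℕ → ℕ) (f : ℕ → ℤ) → (∀ i → + w i ≡ + 1 ℤ.+ f i) → + total n w ≡ + n ℤ.+ sum< n f
total-sum< zero    w f h = refl
total-sum< (suc n) w f h = trans (cong₂ ℤ._+_ (h 0) (total-sum< n (w ∘ suc) (f ∘ suc) (h ∘ suc)))
  (solve 3 (λ n x y → (con (+ 1) :+ x) :+ (n :+ y) := (con (+ 1) :+ n) :+ (x :+ y)) refl (+ n) (f 0) (sum< n (f ∘ suc)))

∣∣-≤ : ∀ {z M} → z ℤ.≤ + M → ℤ.- z ℤ.≤ + M → ℤ.∣ z ∣ ≤ M
∣∣-≤ {+ n}      h _ = ℤ.drop‿+≤+ h
∣∣-≤ { -[1+ n ]} _ h = ℤ.drop‿+≤+ h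

checkAll-at : ∀ {p n b M K} .{{_ : NonZero p}} → checkAll p n b M ≡ true → K < p →
  check p ((n * b) % p) (M + p) (λ y → top p n K y ((y + (p ∸ b)) % p)) (λ y → weight p n K y ((y + (p ∸ b)) % p)) ≡ true ×
  check p ((n * b) % p) (M + p) (λ y → top p n K ((y + (p ∸ b)) % p) y) (λ y → weight p n K ((y + (p ∸ b)) % p) y) ≡ true
checkAll-at ok K<p = if-true (every-upTo ok K<p)

walk-bound : ∀ {p n b M K τ y α ε} .{{_ : NonZero p}} → n ≤ p → checkAll p n b M ≡ true → K < p → τ < p →
  Walk p ((n * b) % p) τ y α ε → (∀ f → total p (f ∘ y) ≡ total p f) →
  ℤ.∣ sum< p (λ i → value p n K (ε i) (α i) (y i) ℤ.- value p n K (ε i) (α i) ((y i + (p ∸ b)) % p)) ∣ ≤ M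
walk-bound {p} {n} {b} {M} {K} {τ} {y} {α} {ε} n≤p ok K<p τ<p w perm =
  ∣∣-≤ (below (λ i → weight p n K (y i) (next (y i)) (ε i) (α i)) _
         (λ i → weight-value p n K (y i) (next (y i)) (ε i) (α i))
         (check-sound {top = λ y → top p n K y (next y)} (proj₁ checks)
           (λ {y} _ → weight≤top p n K n≤p y (next y)) τ<p w (perm _)))
       (subst (ℤ._≤ + M) flip
         (below (λ i → weight p n K (next (y i)) (y i) (ε i) (α i)) _
         (λ i → weight-value p n K (next (y i)) (y i) (ε i) (α i))
         (check-sound {top = λ y → top p n K (next y) y} (proj₂ checks)
           (λ {y} _ → weight≤top p n K n≤p (next y) y) τ<p w (perm _))))
  where
  next : ℕ → ℕ
  next y = (y + (p ∸ b)) % p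
  checks = checkAll-at {n = n} {b} {M} ok K<p
  f g : ℕ → ℤ
  f i = value p n K (ε i) (α i) (y i)
  g i = value p n K (ε i) (α i) (next (y i))
  flip : sum< p (λ i → g i ℤ.- f i) ≡ ℤ.- sum< p (λ i → f i ℤ.- g i)
  flip = trans (sum<-- p g f) (trans (solve 2 (λ a b → b :- a := :- (a :- b)) refl (sum< p f) (sum< p g))
    (cong ℤ.-_ (sym (sum<-- p f g))))
  below : ∀ (w : ℕ → ℕ) (h : ℕ → ℤ) → (∀ i → + w i ≡ + 1 ℤ.+ h i) → total p w ≤ M + p → sum< p h ℤ.≤ + M
  below w h eq le = subst₂ ℤ._≤_
    (trans (cong (ℤ._- + p) (total-sum< p w h eq)) (solve 2 (λ p s → (p :+ s) :- p := s) refl (+ p) (sum< p h)))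
    (solve 2 (λ m p → (m :+ p) :- p := m) refl (+ M) (+ p))
    (ℤ.+-monoˡ-≤ (ℤ.- + p) (ℤ.+≤+ le))

inverse : ∀ {s} → Prime s → ∀ w → ¬ s ∣ w → ∃ λ v → v < s × + s ∣ℤ + w ℤ.* + v ℤ.- + 1
inverse {s} ps w s∤w = reduce (bezout (coprime-Bézout (prime-coprime ps s∤w)))
  where
  instance
    s≢0 : NonZero s
    s≢0 = prime⇒nonZero ps
  bezout : Bézout.Identity 1 w s → ∃ λ z → + s ∣ℤ + w ℤ.* z ℤ.- + 1
  bezout (Bézout.+- x y eq) = + x , ℤ∣.divides (+ y)
    (trans (cong (ℤ._- + 1) (trans (trans (sym (ℤ.pos-* w x)) (cong +_ (trans (ℕ.*-comm w x) (sym eq)))) (cong (ℤ._+_ (+ 1)) (ℤ.pos-* y s))))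
      (solve 2 (λ y s → (con (+ 1) :+ y :* s) :- con (+ 1) := y :* s) refl (+ y) (+ s)))
  bezout (Bézout.-+ x y eq) = ℤ.- + x , ℤ∣.divides (ℤ.- + y)
    (trans (solve 2 (λ w x → w :* (:- x) :- con (+ 1) := :- (con (+ 1) :+ x :* w)) refl (+ w) (+ x))
    (trans (cong ℤ.-_ (trans (cong (ℤ._+_ (+ 1)) (sym (ℤ.pos-* x w))) (trans (cong +_ eq) (ℤ.pos-* y s))))
      (ℤ.neg-distribˡ-* (+ y) (+ s))))
  reduce : (∃ λ z → + s ∣ℤ + w ℤ.* z ℤ.- + 1) → ∃ λ v → v < s × + s ∣ℤ + w ℤ.* + v ℤ.- + 1
  reduce (z , dvd) = z %ℕ s , n%ℕd<d z s , ∣ℤ-combine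
    (solve 3 (λ w z v → w :* v :- con (+ 1) := (w :* z :- con (+ 1)) :+ :- (w :* (z :- v))) refl (+ w) z (+ (z %ℕ s)))
    dvd (ℤ∣.∣m⇒∣-m (ℤ∣.∣n⇒∣m*n (+ w) (%ℕ-∣ z s)))

inverse-positive : ∀ {s} → Prime s → ∀ w {v} → + s ∣ℤ + w ℤ.* + v ℤ.- + 1 → 1 ≤ v
inverse-positive ps w {suc v} _ = s≤s z≤n
inverse-positive {s} ps w {zero} dvd = contradiction
  (ℕ.≤-trans (prime>1 ps) (∣⇒≤ (ℤ∣.∣⇒∣ᵤ (subst (+ s ∣ℤ_) (cong (ℤ._- + 1) (ℤ.*-zeroʳ (+ w))) dvd)))) λ { (s≤s ()) }

-- Φ_pq(x) has the shape used in `binary`: n = q⁻¹ mod p determines m = p⁻¹ mod q.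
cofactors : ∀ {p q n} → Prime p → 1 ≤ q → n < p → 1 ≤ n → p ∣ q * n ∸ 1 →
  ∃ λ m → ∃ λ m′ → p * m + q * n ≡ 1 + p * q × m + m′ ≡ q
cofactors {p} {q} {n} pp 1≤q n<p 1≤n (divides t eq) = q ∸ t , t , bez , ℕ.m∸n+n≡m t≤q
  where
  qn≡ : q * n ≡ 1 + t * p
  qn≡ = trans (sym (ℕ.m+[n∸m]≡n (ℕ.*-mono-≤ 1≤q 1≤n))) (cong suc eq)
  t≤q : t ≤ q
  t≤q = ℕ.*-cancelʳ-≤ t q p {{prime⇒nonZero pp}} (ℕ.≤-trans (ℕ.n≤1+n (t * p))
    (ℕ.≤-trans (ℕ.≤-reflexive (sym qn≡)) (ℕ.*-monoʳ-≤ q (ℕ.<⇒≤ n<p))))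
  bez : p * (q ∸ t) + q * n ≡ 1 + p * q
  bez = trans (cong (_+_ (p * (q ∸ t))) qn≡) (trans (go p (q ∸ t) t) (cong (λ z → 1 + p * z) (ℕ.m∸n+n≡m t≤q)))
    where
    go : ∀ p u t → p * u + (1 + t * p) ≡ 1 + p * (u + t)
    go = solve-∀

-- Rounding grid points to the pair (α, ε)

module Upper {p q r : ℕ} (pp : Prime p) (pq : Prime q) (pr : Prime r) (p<q : p < q) (q<r : q < r)
  {n m m′ n′ : ℕ} (bez : p * m + q * n ≡ 1 + p * q) (hm : m + m′ ≡ q) (hn : n + n′ ≡ p) (k : ℕ) where

  private instance
    p≢0 : NonZero p
    p≢0 = prime⇒nonZero pp
    q≢0 : NonZero q
    q≢0 = prime⇒nonZero pq
    r≢0 : NonZero r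
    r≢0 = prime⇒nonZero pr

  open Coefficient pp pq p<q q<r pr bez hm hn k using (binary-term; e)

  K ν : ℕ
  K = k / r / q
  ν = k / r % q

  α ρ ε : ℕ → ℕ
  α x = p * x / q
  ρ x = p * x % q
  ε x = ind (ν <ᵇ ρ x)

  α<p : ∀ {x} → x < q → α x < p
  α<p {x} x<q = m<n*o⇒m/o<n (ℕ.*-monoʳ-< p x<q)

  -- Here pm = (p - n)q + 1. Thus x < m gives px ≤ pm - p < (p - n)q, as p > 1, and conversely α < p
  -- - n gives px < (p - n)q < pm.
  m-threshold : ∀ x → (suc x ≤ᵇ m) ≡ (α x + n <ᵇ p)
  m-threshold x = ≤ᵇ-cong to from
    where
    open ℕ.≤-Reasoning
    px : p * x ≡ ρ x + α x * q
    px = m≡m%n+[m/n]*n (p * x) q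
    to : suc x ≤ m → α x + n < p
    to x<m = ℕ.≰⇒> λ p≤ → ℕ.<⇒≱ (prime>1 pp) (ℕ.+-cancelʳ-≤ (p * x + q * n) p 1 (begin
      p + (p * x + q * n)  ≡⟨ go p x (q * n) ⟩
      p * suc x + q * n    ≤⟨ ℕ.+-monoˡ-≤ (q * n) (ℕ.*-monoʳ-≤ p x<m) ⟩
      p * m + q * n        ≡⟨ bez ⟩
      1 + p * q            ≤⟨ s≤s (ℕ.*-monoˡ-≤ q p≤) ⟩
      1 + (α x + n) * q    ≡⟨ cong suc (trans (ℕ.*-distribʳ-+ q (α x) n) (cong (_+_ (α x * q)) (ℕ.*-comm n q))) ⟩
      1 + (α x * q + q * n) ≤⟨ s≤s (ℕ.+-monoˡ-≤ (q * n) (ℕ.≤-trans (ℕ.m≤n+m (α x * q) (ρ x)) (ℕ.≤-reflexive (sym px)))) ⟩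
      1 + (p * x + q * n) ∎))
      where
      go : ∀ p x z → p + (p * x + z) ≡ p * suc x + z
      go = solve-∀
    from : α x + n < p → suc x ≤ m
    from α+n<p = ℕ.*-cancelˡ-< p x m (ℕ.+-cancelʳ-< (q * n) (p * x) (p * m) (begin-strict
      p * x + q * n            ≡⟨ cong (_+ q * n) px ⟩
      ρ x + α x * q + q * n    <⟨ ℕ.+-monoˡ-< (q * n) (ℕ.+-monoˡ-< (α x * q) (m%n<n (p * x) q)) ⟩
      q + α x * q + q * n      ≡⟨ go q (α x) n ⟩
      suc (α x + n) * q        ≤⟨ ℕ.*-monoˡ-≤ q α+n<p ⟩
      p * q                    <⟨ ℕ.n<1+n (p * q) ⟩
      1 + p * q                ≡⟨ bez ⟨
      p * m + q * n ∎))
      where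
      go : ∀ q a n → q + a * q + q * n ≡ suc (a + n) * q
      go = solve-∀

  -- In base r the left side has remainder 0, so only the quotient of k′ matters; in base q the
  -- remainders ρ and ν leave the bit ε. The parameter `K′` serves both k, with K, and k + rpq, with
  -- K + p.
  e-threshold : ∀ x y k′ K′ → k′ ≡ k % r + (ν + K′ * q) * r → (e x y ≤ᵇ k′) ≡ (y + (α x + ε x) ≤ᵇ K′)
  e-threshold x y k′ K′ refl = begin
    (e x y ≤ᵇ k′)                                          ≡⟨ cong (_≤ᵇ k′) (ℕ.*-comm r (p * x + q * y)) ⟩
    ((p * x + q * y) * r ≤ᵇ k % r + (ν + K′ * q) * r)      ≡⟨ floor-≤ᵇ r {p * x + q * y} {0} {ν + K′ * q} (ℕ.≤-trans (s≤s z≤n) (m%n<n k r)) (m%n<n k r) ⟩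
    (p * x + q * y + ind (k % r <ᵇ 0) ≤ᵇ ν + K′ * q)       ≡⟨ cong (_≤ᵇ ν + K′ * q) (trans (ℕ.+-identityʳ _) split) ⟩
    (ρ x + (y + α x) * q ≤ᵇ ν + K′ * q)                    ≡⟨ floor-≤ᵇ q {y + α x} {ρ x} {K′} (m%n<n (p * x) q) (m%n<n (k / r) q) ⟩
    (y + α x + ε x ≤ᵇ K′)                                  ≡⟨ cong (_≤ᵇ K′) (ℕ.+-assoc y (α x) (ε x)) ⟩
    (y + (α x + ε x) ≤ᵇ K′) ∎
    where
    open ≡-Reasoning
    split : p * x + q * y ≡ ρ x + (y + α x) * q
    split = trans (cong (_+ q * y) (m≡m%n+[m/n]*n (p * x) q)) (go (ρ x) (α x) y q)
      where
      go : ∀ a b y q → a + b * q + q * y ≡ a + (y + b) * q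
      go = solve-∀

  raise-K : ∀ s ν K p q r → s + (ν + K * q) * r + r * (p * q) ≡ s + (ν + (K + p) * q) * r
  raise-K = solve-∀

  indicator-ind : ∀ b → indicator b ≡ + ind b
  indicator-ind true  = refl
  indicator-ind false = refl

  binary-term-value : ∀ x y → binary-term x y ≡ value p n K (ε x) (α x) y
  binary-term-value x y rewrite m-threshold x
    | e-threshold x y k K (trans (m≡m%n+[m/n]*n k r) (cong (λ z → k % r + z * r) (m≡m%n+[m/n]*n (k / r) q)))
    | e-threshold x y (k + r * (p * q)) (K + p)
        (trans (cong (_+ r * (p * q)) (trans (m≡m%n+[m/n]*n k r) (cong (λ z → k % r + z * r) (m≡m%n+[m/n]*n (k / r) q))))
          (raise-K (k % r) ν K p q r))
    with α x + n <ᵇ p | ℕ.<-≤-connex y n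
  ... | true  | inj₁ y<n rewrite <ᵇ-true y<n = indicator-ind _
  ... | true  | inj₂ n≤y rewrite <ᵇ-false n≤y = refl
  ... | false | inj₁ y<n rewrite <ᵇ-true y<n | ≤ᵇ-false y<n = refl
  ... | false | inj₂ n≤y rewrite <ᵇ-false n≤y | ≤ᵇ-true n≤y = cong ℤ.-_ (indicator-ind _)

module Bound {p q r : ℕ} (pp : Prime p) (pq : Prime q) (pr : Prime r) (p<q : p < q) (q<r : q < r)
  {n m m′ b c : ℕ} (bez : p * m + q * n ≡ 1 + p * q) (hm : m + m′ ≡ q) (n<p : n < p)
  (b<p : b < p) (c<q : c < q) (qn≡1 : + p ∣ℤ + q ℤ.* + n ℤ.- + 1) (rb≡1 : + p ∣ℤ + r ℤ.* + b ℤ.- + 1)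
  (rpc≡1 : + q ∣ℤ + r ℤ.* + p ℤ.* + c ℤ.- + 1) (k : ℕ) where

  private instance
    p≢0 : NonZero p
    p≢0 = prime⇒nonZero pp
    q≢0 : NonZero q
    q≢0 = prime⇒nonZero pq

  hn : n + (p ∸ n) ≡ p
  hn = ℕ.m+[n∸m]≡n (ℕ.<⇒≤ n<p)

  open Grid pp pq pr p<q q<r {n} {b} {c} qn≡1 rb≡1 rpc≡1 k
  open Upper pp pq pr p<q q<r {n} {m} {m′} {p ∸ n} bez hm hn k

  next : ℕ → ℕ
  next y = (y + (p ∸ b)) % p

  formula : a (p * q * r) k ≡ sum< p (λ i → value p n K (ε (x i)) (α (x i)) (y i) ℤ.-
    value p n K (ε (x i)) (α (x i)) (next (y i)))
  formula = trans (a-formula {m} {m′} {p ∸ n} bez hm hn) (sum<-cong p λ i _ → cong₂ ℤ._-_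
    (binary-term-value (x i) (y i))
    (trans (cong (Coefficient.binary-term pp pq p<q q<r pr bez hm hn k (x i)) (y-period (ℕ.<⇒≤ b<p) i))
      (binary-term-value (x i) (next (y i)))))

  -- k is arbitrary and K therefore unbounded, but the checks run over K < p; by `value-cap` the cap
  -- changes no summand.
  K′ : ℕ
  K′ = K ⊓ pred p

  K′<p : K′ < p
  K′<p = ℕ.≤-<-trans (ℕ.m⊓n≤n K (pred p)) (ℕ.≤-reflexive (ℕ.suc-pred p))

  capped : ∀ {x y} → x < q → y < p → value p n K (ε x) (α x) y ≡ value p n K′ (ε x) (α x) y
  capped {x} {y} x<q y<p with ℕ.<-≤-connex K p
  ... | inj₁ K<p = cong (λ K → value p n K (ε x) (α x) y) (sym (ℕ.m≤n⇒m⊓n≡m (ℕ.<⇒≤pred K<p)))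
  ... | inj₂ p≤K = trans (value-cap {p} {n} {K} {ε x} {α x} {y} p≤K (ind≤1 _) (α<p x<q) y<p)
    (cong (λ K → value p n K (ε x) (α x) y) (sym (ℕ.m≥n⇒m⊓n≡n (ℕ.≤-trans ℕ.pred[n]≤n p≤K))))

  walk : Walk p ((n * b) % p) (p * c / q) y (α ∘ x) (ε ∘ x)
  walk = record
    { y<p = y<p ; α<p = λ i → α<p (x<q i) ; ε≤1 = λ i → ind≤1 _
    ; next = y-step ; step = λ i → rotation-step {p} {q} {c} {x i} {x (suc i)} {ν} (x-step c<q i) }

  bounded : ∀ {M} → checkAll p n b M ≡ true → ℤ.∣ a (p * q * r) k ∣ ≤ M
  bounded {M} ok = subst (λ z → ℤ.∣ z ∣ ≤ M)
    (sym (trans formula (sum<-cong p λ i _ → cong₂ ℤ._-_ (capped (x<q i) (y<p i)) (capped (x<q i) (m%n<n (y i + (p ∸ b)) p)))))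
    (walk-bound {p} {n} {b} {M} {K′} {p * c / q} {y} {α ∘ x} {ε ∘ x} (ℕ.<⇒≤ n<p) ok K′<p
      (m<n*o⇒m/o<n (ℕ.*-monoʳ-< p c<q)) walk total-y)

q*n-1 : ∀ {p q n} → 1 ≤ q → 1 ≤ n → p ∣ q * n ∸ 1 → + p ∣ℤ + q ℤ.* + n ℤ.- + 1
q*n-1 {p} {q} {n} 1≤q 1≤n dvd = subst (+ p ∣ℤ_)
  (trans (sym (trans (ℤ.m-n≡m⊖n (q * n) 1) (ℤ.⊖-≥ (ℕ.*-mono-≤ 1≤q 1≤n)))) (cong (ℤ._- + 1) (ℤ.pos-* q n)))
  (ℤ∣.∣ᵤ⇒∣ dvd)

-- The check sees q through n = q⁻¹ mod p and r through b = r⁻¹ mod p, so for given n the p - 1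
-- values of b cover all pairs q, r.
a-bound : ∀ {p q r n M} (pp : Prime p) → Prime q → Prime r → p < q → q < r →
  1 ≤ n → n < p → p ∣ q * n ∸ 1 → (∀ b → 1 ≤ b → b < p → checkAll p n b M {{prime⇒nonZero pp}} ≡ true) →
  ∀ k → ℤ.∣ a (p * q * r) k ∣ ≤ M
a-bound {p} {q} {r} {n} {M} pp pq pr p<q q<r 1≤n n<p dvd ok k =
  let m , m′ , bez , hm = cofactors {p} {q} {n} pp (prime>0 pq) n<p 1≤n dvd
      b , b<p , rb≡1 = inverse pp r (prime-∤ pp pr (ℕ.<⇒≢ (ℕ.<-trans p<q q<r)))
      c , c<q , rpc≡1 = inverse pq (r * p) (∤* pq pr pp (ℕ.<⇒≢ q<r) (ℕ.<⇒≢ p<q ∘ sym))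
  in Bound.bounded pp pq pr p<q q<r {n} {m} {m′} {b} {c} bez hm n<p b<p c<q
       (q*n-1 (prime>0 pq) 1≤n dvd) rb≡1
       (subst (λ z → + q ∣ℤ z ℤ.* + c ℤ.- + 1) (ℤ.pos-* r p) rpc≡1) k {M}
       (ok b (inverse-positive pp r rb≡1) b<p)

-- Heights

A-≤ : ∀ n {M} → (∀ k → ℤ.∣ a n k ∣ ≤ M) → A n ≤ M
A-≤ n {M} h = go (upTo (suc (φ n)))
  where
  go : ∀ ks → foldr _⊔_ 0 (map (λ k → ℤ.∣ a n k ∣) ks) ≤ M
  go []       = z≤n
  go (k ∷ ks) = ℕ.⊔-lub (h k) (go ks)

≤-A : ∀ n {k} → k ≤ φ n → ℤ.∣ a n k ∣ ≤ A n
≤-A n {k} k≤φ = go (∈-upTo⁺ (s≤s k≤φ))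
  where
  go : ∀ {ks} → k ∈ ks → ℤ.∣ a n k ∣ ≤ foldr _⊔_ 0 (map (λ k → ℤ.∣ a n k ∣) ks)
  go (here refl) = ℕ.m≤m⊔n _ _
  go (there k∈)  = ℕ.≤-trans (go k∈) (ℕ.m≤n⊔m _ _)

unique-⊆⇒length≤ : ∀ {X : Set} {xs ys : List X} → Unique xs → (∀ {x} → x ∈ xs → x ∈ ys) → length xs ≤ length ys
unique-⊆⇒length≤ {xs = []} u inc = z≤n
unique-⊆⇒length≤ {xs = x ∷ xs} (x∉ ∷ u) inc with ∈-∃++ (inc (here refl))
... | ys , zs , refl = ℕ.≤-trans (s≤s (unique-⊆⇒length≤ u shrink)) (ℕ.≤-reflexive (sym (List.length-++-sucʳ ys x zs)))
  where
  shrink : ∀ {z} → z ∈ xs → z ∈ ys ++ zs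
  shrink z∈ with ∈-++⁻ ys (inc (there z∈))
  ... | inj₁ z∈ys          = ∈-++⁺ˡ z∈ys
  ... | inj₂ (here refl)   = contradiction refl (All.lookup x∉ z∈)
  ... | inj₂ (there z∈zs)  = ∈-++⁺ʳ ys z∈zs

-- k ≤ φ(n) could be decided by evaluation, but counting multiples of p, q and r is much cheaper.
φ-lower : ∀ {p q r} → Prime p → Prime q → Prime r →
  p * q * r ≤ φ (p * q * r) + (suc (q * r) + (suc (p * r) + suc (p * q)))
φ-lower {p} {q} {r} pp pq pr = subst₂ _≤_
  (trans (List.length-map suc (upTo N)) (List.length-applyUpTo id N))
  (trans (List.length-++ coprimes) (cong (_+_ (φ N))
    (trans (List.length-++ (multiplesOf p (q * r))) (cong₂ _+_ (len p (q * r))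
      (trans (List.length-++ (multiplesOf q (p * r))) (cong₂ _+_ (len q (p * r)) (len r (p * q))))))))
  (unique-⊆⇒length≤ (Unique.map⁺ ℕ.suc-injective (Unique.upTo⁺ N)) covered)
  where
  N : ℕ
  N = p * q * r
  coprimes : List ℕ
  coprimes = filter (λ k → gcd k N ℕ.≟ 1) (map suc (upTo N))
  multiplesOf : ℕ → ℕ → List ℕ
  -- The multiple 0 is listed as well, which weakens the bound by one for each prime.
  multiplesOf s t = map (s *_) (upTo (suc t))
  len : ∀ s t → length (multiplesOf s t) ≡ suc t
  len s t = trans (List.length-map (s *_) (upTo (suc t))) (List.length-applyUpTo id (suc t))
  ∈-multiples : ∀ {s t k} → Prime s → s * t ≡ N → k ≤ N → s ∣ k → k ∈ multiplesOf s t
  ∈-multiples {s} {t} ps st≡N k≤N (divides d refl) = subst (_∈ multiplesOf s t) (ℕ.*-comm s d)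
    (∈-map⁺ (s *_) (∈-upTo⁺ (s≤s (ℕ.*-cancelˡ-≤ s {{prime⇒nonZero ps}}
      (subst₂ _≤_ (ℕ.*-comm d s) (sym st≡N) k≤N)))))
  N≡ : N ≡ product (p ∷ q ∷ r ∷ [])
  N≡ = go p q r
    where
    go : ∀ p q r → p * q * r ≡ p * (q * (r * 1))
    go = solve-∀
  eq : q * (p * r) ≡ N
  eq = go p q r
    where
    go : ∀ p q r → q * (p * r) ≡ p * q * r
    go = solve-∀
  covered : ∀ {k} → k ∈ map suc (upTo N) → k ∈ coprimes ++ (multiplesOf p (q * r) ++ (multiplesOf q (p * r) ++ multiplesOf r (p * q)))
  covered {k} k∈ with gcd k N ℕ.≟ 1
  ... | yes g≡1 = ∈-++⁺ˡ (∈-filter⁺ (λ k → gcd k N ℕ.≟ 1) k∈ g≡1)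
  ... | no g≢1 = ∈-++⁺ʳ coprimes (by-factor (prime-factor (pp ∷ pq ∷ pr ∷ []) (subst (gcd k N ∣_) N≡ (gcd[m,n]∣n k N)) g≢1))
    where
    k≤N : k ≤ N
    k≤N with ∈-map⁻ suc k∈
    ... | j , j∈ , refl = ∈-upTo⁻ j∈
    by-factor : (∃ λ s → s ∈ p ∷ q ∷ r ∷ [] × s ∣ gcd k N) → k ∈ multiplesOf p (q * r) ++ (multiplesOf q (p * r) ++ multiplesOf r (p * q))
    by-factor (s , here refl , s∣g) = ∈-++⁺ˡ (∈-multiples pp (sym (ℕ.*-assoc p q r)) k≤N (∣-trans s∣g (gcd[m,n]∣m k N)))
    by-factor (s , there (here refl) , s∣g) = ∈-++⁺ʳ (multiplesOf p (q * r)) (∈-++⁺ˡ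
      (∈-multiples pq eq k≤N (∣-trans s∣g (gcd[m,n]∣m k N))))
    by-factor (s , there (there (here refl)) , s∣g) = ∈-++⁺ʳ (multiplesOf p (q * r)) (∈-++⁺ʳ (multiplesOf q (p * r))
      (∈-multiples pr (ℕ.*-comm r (p * q)) k≤N (∣-trans s∣g (gcd[m,n]∣m k N))))

∧-split : ∀ {b c} → b ∧ c ≡ true → b ≡ true × c ≡ true
∧-split {true} eq = refl , eq

≤ᵇ-≤ : ∀ {i j} → (i ≤ᵇ j) ≡ true → i ≤ j
≤ᵇ-≤ {i} {j} eq = ℕ.≤ᵇ⇒≤ i j (subst T (sym eq) _)

≡ᵇ-≡ : ∀ {i j} → (i ≡ᵇ j) ≡ true → i ≡ j
≡ᵇ-≡ {i} {j} eq = ℕ.≡ᵇ⇒≡ i j (subst T (sym eq) _)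

%≡1⇒∣ : ∀ {s w} .{{_ : NonZero s}} → w % s ≡ 1 → + s ∣ℤ + w ℤ.- + 1
%≡1⇒∣ {s} {w} eq = ℤ∣.divides (+ (w / s)) (trans
  (cong (λ z → + z ℤ.- + 1) (trans (m≡m%n+[m/n]*n w s) (cong (_+ w / s * s) eq)))
  (trans (solve 1 (λ x → (con (+ 1) :+ x) :- con (+ 1) := x) refl (+ (w / s * s))) (ℤ.pos-* (w / s) s)))

-- u = p⁻¹ mod q, n = q⁻¹ mod p, b = r⁻¹ mod p, c = (rp)⁻¹ mod q; the coefficient of index k is the large one.
record Witness : Set where
  constructor witness
  field
    q r k u n b c : ℕ

module _ (p β v : ℕ) .{{_ : NonZero p}} (w : Witness) where
  open Witness w

  attains : .{{_ : NonZero q}} → Bool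
  attains = (p <ᵇ q) ∧ (q <ᵇ r) ∧ (β ≤ᵇ q) ∧ ((q ∸ β) % p ≡ᵇ 0) ∧
    ((q * n) % p ≡ᵇ 1) ∧ ((r * b) % p ≡ᵇ 1) ∧ ((r * p * c) % q ≡ᵇ 1) ∧
    (p * u + q * n ≡ᵇ 1 + p * q) ∧ (u ≤ᵇ q) ∧ (n ≤ᵇ p) ∧
    -- By `φ-lower` this gives k ≤ φ(pqr), so that the coefficient counts towards the height.
    (k + (suc (q * r) + (suc (p * r) + suc (p * q))) ≤ᵇ p * q * r) ∧
    (v ≤ᵇ ℤ.∣ coefficient p q r u n b c k ∣)

  attained : .{{_ : NonZero q}} → Prime p → Prime q → Prime r → attains ≡ true →
    p < q × q < r × p ∣ q ∸ β × v ≤ A (p * q * r)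
  attained pp pq pr ok =
    let p<q , ok = ∧-split {p <ᵇ q} ok
        q<r , ok = ∧-split {q <ᵇ r} ok
        _   , ok = ∧-split {β ≤ᵇ q} ok
        q≡β , ok = ∧-split {(q ∸ β) % p ≡ᵇ 0} ok
        qn  , ok = ∧-split {(q * n) % p ≡ᵇ 1} ok
        rb  , ok = ∧-split {(r * b) % p ≡ᵇ 1} ok
        rpc , ok = ∧-split {(r * p * c) % q ≡ᵇ 1} ok
        bez , ok = ∧-split {p * u + q * n ≡ᵇ 1 + p * q} ok
        u≤q , ok = ∧-split {u ≤ᵇ q} ok
        n≤p , ok = ∧-split {n ≤ᵇ p} ok
        k≤  , v≤ = ∧-split {k + (suc (q * r) + (suc (p * r) + suc (p * q))) ≤ᵇ p * q * r} ok
        p<q = ≤ᵇ-≤ {suc p} p<q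
        q<r = ≤ᵇ-≤ {suc q} q<r
        formula = Grid.a-formula pp pq pr p<q q<r {n} {b} {c}
          (subst (λ z → + p ∣ℤ z ℤ.- + 1) (ℤ.pos-* q n) (%≡1⇒∣ (≡ᵇ-≡ qn)))
          (subst (λ z → + p ∣ℤ z ℤ.- + 1) (ℤ.pos-* r b) (%≡1⇒∣ (≡ᵇ-≡ rb)))
          (subst (λ z → + q ∣ℤ z ℤ.- + 1) (trans (ℤ.pos-* (r * p) c) (cong (ℤ._* + c) (ℤ.pos-* r p))) (%≡1⇒∣ (≡ᵇ-≡ rpc)))
          k {u} {q ∸ u} {p ∸ n} (≡ᵇ-≡ bez) (ℕ.m+[n∸m]≡n (≤ᵇ-≤ {u} u≤q)) (ℕ.m+[n∸m]≡n (≤ᵇ-≤ {n} n≤p))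
    in p<q , q<r , m%n≡0⇒n∣m (q ∸ β) p (≡ᵇ-≡ q≡β) ,
       ℕ.≤-trans (≤ᵇ-≤ v≤) (subst (λ z → ℤ.∣ z ∣ ≤ A (p * q * r)) formula
         (≤-A (p * q * r) (ℕ.+-cancelʳ-≤ _ k (φ (p * q * r)) (ℕ.≤-trans (≤ᵇ-≤ k≤) (φ-lower pp pq pr)))))

-- The maximum over r need not be computable, but it does not fail to exist.
maximum-¬¬ : ∀ p q B → (∀ r → Prime r → q < r → A (p * q * r) ≤ B) →
  ∀ d {r} → Prime r → q < r → B ≤ A (p * q * r) + d → ¬ ¬ ∃ λ M → IsM p q M × A (p * q * r) ≤ M
maximum-¬¬ p q B bound zero {r} pr q<r B≤ none = none
  (A (p * q * r) , ((r , pr , q<r , refl) , λ s ps q<s →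
    ℕ.≤-trans (bound s ps q<s) (ℕ.≤-trans B≤ (ℕ.≤-reflexive (ℕ.+-identityʳ _)))) , ℕ.≤-refl)
maximum-¬¬ p q B bound (suc d) {r} pr q<r B≤ none = none
  (A (p * q * r) , ((r , pr , q<r , refl) , λ s ps q<s → ℕ.≮⇒≥ λ Ar<As →
    -- A prime s with a larger height brings the distance to B down by at least one.
    maximum-¬¬ p q B bound d {s} ps q<s
      (ℕ.≤-trans B≤ (ℕ.≤-trans (ℕ.≤-reflexive (ℕ.+-suc _ d)) (ℕ.+-monoˡ-≤ d Ar<As)))
      λ (M , isM , As≤M) → none (M , isM , ℕ.≤-trans (ℕ.<⇒≤ Ar<As) As≤M)) , ℕ.≤-refl)

-- From the checks to the table

boundedBy : (p β v : ℕ) (bold : Bool) .{{_ : NonZero p}} → Bool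
boundedBy p β v bold = every (λ j → if (suc j * β) % p ≡ᵇ 1
  then (if every (λ b → checkAll p (suc j) (suc b) (m p (suc j))) (upTo (pred p))
        then (if bold then m p (suc j) ≡ᵇ v else true) else false)
  else true) (upTo (pred p))

Conclusion : Entry → Set
Conclusion (entry p β v bold) = (β* : ℕ) → 1 ≤ β* → β* ≤ p ∸ 1 → p ∣ β* * β ∸ 1 →
  (Mβ : ℕ) → IsMβ p β Mβ → (v ≤ Mβ × Mβ ≤ m p β*) × (bold ≡ true → Mβ ≡ v)

module _ {p β v : ℕ} {bold : Bool} (pp : Prime p) (1≤β : 1 ≤ β) (β<p : β < p) where
  private instance
    p≢0 : NonZero p
    p≢0 = prime⇒nonZero pp

  inverse-% : ∀ {β*} → 1 ≤ β* → p ∣ β* * β ∸ 1 → (β* * β) % p ≡ 1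
  inverse-% {β*} 1≤β* (divides t eq) = trans
    (cong (_% p) (trans (sym (ℕ.m+[n∸m]≡n (ℕ.*-mono-≤ 1≤β* 1≤β))) (cong suc eq)))
    (trans ([m+kn]%n≡m%n 1 t p) (m<n⇒m%n≡m (prime>1 pp)))

  -- The check runs over all candidates for β* and its guard singles out the inverse of β, so any
  -- given β* can be looked up. For a bold entry it also compares the upper bound with v.
  boundedBy-at : boundedBy p β v bold ≡ true → ∀ {β*} → 1 ≤ β* → β* ≤ p ∸ 1 → p ∣ β* * β ∸ 1 →
    (∀ b → 1 ≤ b → b < p → checkAll p β* b (m p β*) ≡ true) × (bold ≡ true → m p β* ≡ v)
  boundedBy-at ok {suc j} 1≤β* β*≤ dvd with every-upTo ok β*≤
  ... | here′ rewrite inverse-% 1≤β* dvd =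
    (λ { (suc b) _ b<p → every-upTo (proj₁ (if-true here′)) (ℕ.<⇒≤pred b<p) }) ,
    λ { refl → ≡ᵇ-≡ (proj₂ (if-true here′)) }

  lift-inverse : ∀ {β* q} → 1 ≤ β* → p < q → p ∣ q ∸ β → p ∣ β* * β ∸ 1 → p ∣ q * β* ∸ 1
  lift-inverse {β*} {q} 1≤β* p<q (divides s eq) (divides t eq′) = divides (t + s * β*) (cong (_∸ 1) (begin
    q * β*                     ≡⟨ cong (_* β*) (sym (ℕ.m+[n∸m]≡n (ℕ.<⇒≤ (ℕ.<-trans β<p p<q)))) ⟩
    (β + (q ∸ β)) * β*         ≡⟨ cong (λ z → (β + z) * β*) eq ⟩
    (β + s * p) * β*           ≡⟨ go β s p β* ⟩
    β* * β + s * β* * p        ≡⟨ cong (_+ s * β* * p) (trans (sym (ℕ.m+[n∸m]≡n (ℕ.*-mono-≤ 1≤β* 1≤β))) (cong suc eq′)) ⟩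
    1 + t * p + s * β* * p     ≡⟨ cong suc (sym (ℕ.*-distribʳ-+ p t (s * β*))) ⟩
    suc ((t + s * β*) * p) ∎))
    where
    open ≡-Reasoning
    go : ∀ β s p i → (β + s * p) * i ≡ i * β + s * i * p
    go = solve-∀

  -- Mβ is itself a height A(pq′r′) with q′ ≡ β, which gives the upper bound. From below, the height
  -- of the witness is at most M(p;q) for its q, and hence at most Mβ.
  conclude : (w : Witness) .{{_ : NonZero (Witness.q w)}} → Prime (Witness.q w) → Prime (Witness.r w) →
    boundedBy p β v bold ≡ true → attains p β v w ≡ true → Conclusion (entry p β v bold)
  conclude w pq pr upper lower β* 1≤β* β*≤ dvd Mβ isMβ@((q′ , pq′ , p<q′ , q′≡β , (r′ , pr′ , q′<r′ , A≡Mβ) , _) , largest) =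
    (v≤Mβ , Mβ≤) , λ isBold → ℕ.≤-antisym (ℕ.≤-trans Mβ≤ (ℕ.≤-reflexive (proj₂ checks isBold))) v≤Mβ
    where
    open Witness w using (q; r)
    checks : (∀ b → 1 ≤ b → b < p → checkAll p β* b (m p β*) ≡ true) × (bold ≡ true → m p β* ≡ v)
    checks = boundedBy-at upper {β*} 1≤β* β*≤ dvd
    bound : ∀ {q r} → Prime q → Prime r → p < q → q < r → p ∣ q ∸ β → A (p * q * r) ≤ m p β*
    bound {q} {r} pq pr p<q q<r q≡β = A-≤ (p * q * r) {m p β*}
      (a-bound {p} {q} {r} {β*} {m p β*} pp pq pr p<q q<r 1≤β* (ℕ.≤-trans (s≤s β*≤) (ℕ.≤-reflexive (ℕ.suc-pred p)))
        (lift-inverse {β*} {q} 1≤β* p<q q≡β dvd) (proj₁ checks))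
    Mβ≤ : Mβ ≤ m p β*
    Mβ≤ = subst (_≤ m p β*) A≡Mβ (bound {q′} {r′} pq′ pr′ p<q′ q′<r′ q′≡β)
    attaining : p < q × q < r × p ∣ q ∸ β × v ≤ A (p * q * r)
    attaining = attained p β v w pp pq pr lower
    at-least : p < q × q < r × p ∣ q ∸ β × v ≤ A (p * q * r) → v ≤ Mβ
    at-least (p<q , q<r , q≡β , v≤A) = decidable-stable (v ℕ.≤? Mβ) λ v≰Mβ →
      maximum-¬¬ p q (m p β*) (λ s ps q<s → bound {q} {s} pq ps p<q q<s q≡β) (m p β*) {r} pr q<r
        (ℕ.m≤n+m (m p β*) (A (p * q * r)))
        λ (M , isM , A≤M) → v≰Mβ (ℕ.≤-trans v≤A (ℕ.≤-trans A≤M (largest q pq p<q q≡β M isM)))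
    v≤Mβ : v ≤ Mβ
    v≤Mβ = at-least attaining

prime! : ∀ n → {_ : True (prime? n)} → Prime n
prime! n {ok} = toWitness ok

-- In each entry the numbers are q, r, k, u, n, b, c, with n = β*. The last two `refl` carry out the
-- computations: one evaluates `boundedBy`, the other `attains`.
entry-3-1 : Conclusion (entry 3 1 2 true)
entry-3-1 = conclude (prime! 3) (≤ᵇ-≤ {1} refl) (≤ᵇ-≤ {2} refl)
  (witness 7 13 21 5 1 1 2) (prime! 7) (prime! 13) refl refl

entry-5-1 : Conclusion (entry 5 1 3 true)
entry-5-1 = conclude (prime! 5) (≤ᵇ-≤ {1} refl) (≤ᵇ-≤ {2} refl)
  (witness 11 17 292 9 1 3 7) (prime! 11) (prime! 17) refl refl

entry-5-2 : Conclusion (entry 5 2 3 true)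
entry-5-2 = conclude (prime! 5) (≤ᵇ-≤ {1} refl) (≤ᵇ-≤ {3} refl)
  (witness 7 11 119 3 3 1 6) (prime! 7) (prime! 11) refl refl

entry-7-1 : Conclusion (entry 7 1 4 true)
entry-7-1 = conclude (prime! 7) (≤ᵇ-≤ {1} refl) (≤ᵇ-≤ {2} refl)
  (witness 29 79 5767 25 1 4 15) (prime! 29) (prime! 79) refl refl

entry-7-2 : Conclusion (entry 7 2 4 true)
entry-7-2 = conclude (prime! 7) (≤ᵇ-≤ {1} refl) (≤ᵇ-≤ {3} refl)
  (witness 23 31 1523 10 4 5 7) (prime! 23) (prime! 31) refl refl

entry-7-3 : Conclusion (entry 7 3 4 true)
entry-7-3 = conclude (prime! 7) (≤ᵇ-≤ {1} refl) (≤ᵇ-≤ {4} refl)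
  (witness 17 23 875 5 5 4 15) (prime! 17) (prime! 23) refl refl

entry-11-1 : Conclusion (entry 11 1 6 true)
entry-11-1 = conclude (prime! 11) (≤ᵇ-≤ {1} refl) (≤ᵇ-≤ {2} refl)
  (witness 67 1663 520519 61 1 6 34) (prime! 67) (prime! 1663) refl refl

entry-11-2 : Conclusion (entry 11 2 6 true)
entry-11-2 = conclude (prime! 11) (≤ᵇ-≤ {1} refl) (≤ᵇ-≤ {3} refl)
  (witness 13 71 4620 6 6 9 1) (prime! 13) (prime! 71) refl refl

entry-11-3 : Conclusion (entry 11 3 7 true)
entry-11-3 = conclude (prime! 11) (≤ᵇ-≤ {1} refl) (≤ᵇ-≤ {4} refl)
  (witness 113 1481 518466 72 4 8 6) (prime! 113) (prime! 1481) refl refl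

entry-11-4 : Conclusion (entry 11 4 7 true)
entry-11-4 = conclude (prime! 11) (≤ᵇ-≤ {1} refl) (≤ᵇ-≤ {5} refl)
  (witness 59 421 84259 43 3 4 57) (prime! 59) (prime! 421) refl refl

entry-11-5 : Conclusion (entry 11 5 6 false)
entry-11-5 = conclude (prime! 11) (≤ᵇ-≤ {1} refl) (≤ᵇ-≤ {6} refl)
  (witness 71 163 56308 13 9 5 4) (prime! 71) (prime! 163) refl refl

entry-13-1 : Conclusion (entry 13 1 7 true)
entry-13-1 = conclude (prime! 13) (≤ᵇ-≤ {1} refl) (≤ᵇ-≤ {2} refl)
  (witness 79 1987 916096 73 1 6 39) (prime! 79) (prime! 1987) refl refl

entry-13-2 : Conclusion (entry 13 2 7 true)
entry-13-2 = conclude (prime! 13) (≤ᵇ-≤ {1} refl) (≤ᵇ-≤ {3} refl)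
  (witness 41 569 112663 19 7 4 29) (prime! 41) (prime! 569) refl refl

entry-13-3 : Conclusion (entry 13 3 7 false)
entry-13-3 = conclude (prime! 13) (≤ᵇ-≤ {1} refl) (≤ᵇ-≤ {4} refl)
  (witness 29 199 30248 9 9 10 5) (prime! 29) (prime! 199) refl refl

entry-13-4 : Conclusion (entry 13 4 8 true)
entry-13-4 = conclude (prime! 13) (≤ᵇ-≤ {1} refl) (≤ᵇ-≤ {5} refl)
  (witness 43 1447 311105 10 10 10 28) (prime! 43) (prime! 1447) refl refl

entry-13-5 : Conclusion (entry 13 5 8 true)
entry-13-5 = conclude (prime! 13) (≤ᵇ-≤ {1} refl) (≤ᵇ-≤ {6} refl)
  (witness 31 1097 137160 12 8 8 1) (prime! 31) (prime! 1097) refl refl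

entry-13-6 : Conclusion (entry 13 6 7 false)
entry-13-6 = conclude (prime! 13) (≤ᵇ-≤ {1} refl) (≤ᵇ-≤ {7} refl)
  (witness 71 557 179982 11 11 6 70) (prime! 71) (prime! 557) refl refl

entry-19-1 : Conclusion (entry 19 1 10 true)
entry-19-1 = conclude (prime! 19) (≤ᵇ-≤ {1} refl) (≤ᵇ-≤ {2} refl)
  (witness 191 13963 23472011 181 1 9 95) (prime! 191) (prime! 13963) refl refl

entry-19-2 : Conclusion (entry 19 2 10 true)
entry-19-2 = conclude (prime! 19) (≤ᵇ-≤ {1} refl) (≤ᵇ-≤ {3} refl)
  (witness 59 439 215557 28 10 10 51) (prime! 59) (prime! 439) refl refl

entry-19-3 : Conclusion (entry 19 3 10 false)
entry-19-3 = conclude (prime! 19) (≤ᵇ-≤ {1} refl) (≤ᵇ-≤ {4} refl)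
  (witness 79 12671 8375612 25 13 9 11) (prime! 79) (prime! 12671) refl refl

entry-19-4 : Conclusion (entry 19 4 12 true)
entry-19-4 = conclude (prime! 19) (≤ᵇ-≤ {1} refl) (≤ᵇ-≤ {5} refl)
  (witness 61 5039 2156771 45 5 5 21) (prime! 61) (prime! 5039) refl refl

entry-19-5 : Conclusion (entry 19 5 11 false)
entry-19-5 = conclude (prime! 19) (≤ᵇ-≤ {1} refl) (≤ᵇ-≤ {6} refl)
  (witness 157 19753 18627236 124 4 8 104) (prime! 157) (prime! 19753) refl refl

entry-19-6 : Conclusion (entry 19 6 9 false)
entry-19-6 = conclude (prime! 19) (≤ᵇ-≤ {1} refl) (≤ᵇ-≤ {7} refl)
  (witness 139 3347 2673199 22 16 13 2) (prime! 139) (prime! 3347) refl refl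

entry-19-7 : Conclusion (entry 19 7 11 true)
entry-19-7 = conclude (prime! 19) (≤ᵇ-≤ {1} refl) (≤ᵇ-≤ {8} refl)
  (witness 83 1759 911174 35 11 7 80) (prime! 83) (prime! 1759) refl refl

entry-19-8 : Conclusion (entry 19 8 11 false)
entry-19-8 = conclude (prime! 19) (≤ᵇ-≤ {1} refl) (≤ᵇ-≤ {9} refl)
  (witness 103 1489 921800 38 12 11 3) (prime! 103) (prime! 1489) refl refl

entry-19-9 : Conclusion (entry 19 9 10 false)
entry-19-9 = conclude (prime! 19) (≤ᵇ-≤ {1} refl) (≤ᵇ-≤ {10} refl)
  (witness 199 7541 12269931 21 17 9 198) (prime! 199) (prime! 7541) refl refl

conclusions : All Conclusion table
conclusions =
  entry-3-1 ∷
  entry-5-1 ∷ entry-5-2 ∷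
  entry-7-1 ∷ entry-7-2 ∷ entry-7-3 ∷
  entry-11-1 ∷ entry-11-2 ∷ entry-11-3 ∷ entry-11-4 ∷ entry-11-5 ∷
  entry-13-1 ∷ entry-13-2 ∷ entry-13-3 ∷ entry-13-4 ∷ entry-13-5 ∷ entry-13-6 ∷
  entry-19-1 ∷ entry-19-2 ∷ entry-19-3 ∷ entry-19-4 ∷ entry-19-5 ∷ entry-19-6 ∷ entry-19-7 ∷ entry-19-8 ∷ entry-19-9 ∷
  []

theorem1p8 : (p β v : ℕ) (b : Bool) → entry p β v b ∈ table →
    (β* : ℕ) → 1 ≤ β* → β* ≤ p ∸ 1 → p ∣ β* * β ∸ 1 →
    (Mβ : ℕ) → IsMβ p β Mβ →
    (v ≤ Mβ × Mβ ≤ m p β*) × (b ≡ true → Mβ ≡ v)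
theorem1p8 p β v b e∈ = All.lookup conclusions e∈
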